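{- Let $r\ge1$ and let $b_1\ge\cdots\ge b_r$ be integers with $b_i\ge i$ for all $i$. Let $I=[x,y]$ be any interval of the augmented Ferrers-cell lattice $\widehat F_{\mathbf b}=F_{\mathbf b}\sqcup\{\widehat0\}$, and give $I$ the induced rank function $\widehat\rho_I(z)=\widehat\rho(z)-\widehat\rho(x)$. Then $$\mathbb{H}_{I,\widehat\rho_I}(q,t)\in\mathbb{N}[q,t].$$
   Context: $\mathbb N=\{0,1,2,\dots\}$. $q$-Zeta numerator: let $P$ be a finite graded poset with a unique maximum and rank function $\rho:P\to\{0,\dots,H\}$, where $H$ is the maximal rank. For $m\ge 0$ put $A_m(P,\rho;q)=\sum_{x_1\le\cdots\le x_m}q^{\rho(x_1)+\cdots+\rho(x_m)}$ (sum over weak chains in $P$; $A_0=1$). The numerator $\mathbb{H}_{P,\rho}(q,t)$ is the polynomial determined by $\sum_{m\ge 0}A_m(P,\rho;q)t^m=\mathbb{H}_{P,\rho}(q,t)/\prod_{a=0}^{H}(1-q^at)$. Ferrers-cell poset: $F_{\mathbf b}=\{(i,c):1\le i\le r,\ i\le c\le b_i\}$, ordered by $(i,c)\le(j,d)\iff i\ge j$ and $c\le d$. $\widehat F_{\mathbf b}$ is obtained by adjoining a new minimum $\widehat0$ below every cell, with rank $\widehat\rho(\widehat0)=0$ and $\widehat\rho(i,c)=c-i+1$. -}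

module Defs where

open import Data.Bool.Base using (if_then_else_)
open import Data.Fin.Base as Fin using (Fin; zero; suc; toℕ; inject₁)
import Data.Fin.Properties as Fin
open import Data.Integer.Base as ℤ using (ℤ; +_; 0ℤ; 1ℤ)
import Data.Integer.Properties as ℤ
open import Data.Irrelevant using ([_])
open import Data.List.Base as List
  using (List; []; _∷_; foldr; filter; concatMap; upTo; allFin; cartesianProductWith)
import Data.List.Membership.Propositional.Properties as ∈
open import Data.List.Membership.Propositional using (_∈_; lose)
open import Data.List.Relation.Unary.All as All using ([]; _∷_)
import Data.List.Relation.Unary.All.Properties as All
import Data.List.Relation.Unary.AllPairs as AllPairs
import Data.List.Relation.Unary.AllPairs.Properties as AllPairs
open import Data.List.Relation.Unary.Any using (here; there)
open import Data.List.Relation.Unary.Unique.Propositional using (Unique; []; _∷_)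
import Data.List.Relation.Unary.Unique.Propositional.Properties as Unique
open import Data.Nat.Base
  using (ℕ; zero; suc; _+_; _∸_; _≤_; _<_; _≥_; _≡ᵇ_; z≤n; s≤s)
import Data.Nat.Properties as ℕ
open import Data.Product.Base using (Σ-syntax; ∃-syntax; _×_; _,_; proj₁; proj₂)
import Data.Product.Properties as Product
open import Data.Refinement.Base using (Refinement-syntax; _,_; value)
open import Data.Sum.Base as Sum using (_⊎_; inj₁; inj₂)
open import Data.Vec.Base as Vec using (Vec; []; _∷_)
open import Data.Vec.Relation.Unary.Linked using (linked?)
open import Function.Base using (_∘_; _on_)
open import Relation.Binary.Construct.Add.Infimum.NonStrict
  using (_≤₋_; ⊥₋≤_; [_]; ≤₋-isDecPartialOrder-≡)
open import Level using (0ℓ)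
open import Relation.Binary.Core using (Rel)
open import Relation.Binary.Definitions using (Maximum)
open import Relation.Binary.PropositionalEquality
open import Relation.Binary.Structures using (IsDecPartialOrder)
open import Relation.Nullary
  using (¬_; yes; no; contradiction; recompute; _×-dec_)
open import Relation.Nullary.Construct.Add.Infimum using (_₋; ⊥₋; [_])
open import Relation.Nullary.Decidable using (map′)
open import Relation.Unary using (Pred; Decidable)

open import Algebra.Properties.Semiring.Sum ℤ.+-*-semiring using (sum⁺-syntax)

Covers : {A : Set} → Rel A 0ℓ → Rel A 0ℓ
Covers _≤_ x y =
  x ≤ y × x ≢ y × (∀ z → x ≤ z → z ≤ y → z ≡ x ⊎ z ≡ y)

record FiniteGradedPoset : Set₁ where
  infix 4 _≤ᴾ_
  field
    Carrier            : Set
    _≤ᴾ_               : Rel Carrier 0ℓ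
    isDecPartialOrder  : IsDecPartialOrder _≡_ _≤ᴾ_

    -- Finiteness: every element is listed exactly once.
    elements           : List Carrier
    elements-complete  : ∀ x → x ∈ elements
    elements-unique    : Unique elements

    ⊤                  : Carrier
    maximum            : Maximum _≤ᴾ_ ⊤

    rank               : Carrier → ℕ
    rank-minimal       : ∀ x → (∀ y → y ≤ᴾ x → y ≡ x) → rank x ≡ 0
    -- Follows from rank-cover, the poset being finite.
    rank-strict        : ∀ x y → x ≤ᴾ y → x ≢ y → rank x < rank y
    rank-cover         : ∀ x y → Covers _≤ᴾ_ x y → rank y ≡ suc (rank x)

  open IsDecPartialOrder isDecPartialOrder public
    using (_≟_; reflexive; antisym)
    renaming (_≤?_ to _≤ᴾ?_; refl to ≤ᴾ-refl; trans to ≤ᴾ-trans)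

  rank-mono : ∀ x y → x ≤ᴾ y → rank x ≤ rank y
  rank-mono x y x≤y with x ≟ y
  ... | yes refl = ℕ.≤-refl
  ... | no  x≢y  = ℕ.<⇒≤ (rank-strict x y x≤y x≢y)

  -- By rank-mono, this is the largest value of rank.
  height : ℕ
  height = rank ⊤

-- Formal power series in t and q over ℤ: f m n is the coefficient of
-- tᵐ qⁿ.
Series : Set
Series = ℕ → ℕ → ℤ

infixl 7 _·_
_·_ : Series → Series → Series
(f · g) m n =
  ∑[ i ≤ m ] ∑[ j ≤ n ] (f (toℕ i) (toℕ j) ℤ.* g (m ∸ toℕ i) (n ∸ toℕ j))

q^_ : ℕ → ℕ → ℤ
(q^ a) n = if a ≡ᵇ n then 1ℤ else 0ℤ

1-q^_t : ℕ → Series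
1-q^ a t 0             n = (q^ 0) n
1-q^ a t 1             n = ℤ.- (q^ a) n
1-q^ a t (suc (suc _)) n = 0ℤ

-- ∏_{a=0}^{H} (1 - qᵃ t)
denominator : ℕ → Series
denominator zero    = 1-q^ 0 t
denominator (suc H) = denominator H · 1-q^ suc H t

module _ (P : FiniteGradedPoset) where
  open FiniteGradedPoset P

  tuples : (m : ℕ) → List (Vec Carrier m)
  tuples zero    = [] ∷ []
  tuples (suc m) = cartesianProductWith _∷_ elements (tuples m)

  weakChains : (m : ℕ) → List (Vec Carrier m)
  weakChains m = filter (linked? _≤ᴾ?_) (tuples m)

  totalRank : ∀ {m} → Vec Carrier m → ℕ
  totalRank c = Vec.sum (Vec.map rank c)

  -- qZeta m n is the coefficient of qⁿ in A_m(P, rank; q).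
  qZeta : Series
  qZeta m n = foldr ℤ._+_ 0ℤ (List.map (λ c → (q^ totalRank c) n) (weakChains m))

  -- The only series h with qZeta = h / ∏_{a=0}^{H} (1 - qᵃ t), obtained by
  -- clearing the denominator (a unit of ℤ[q][[t]]).  Nothing here says that
  -- it is a polynomial; _∈ℕ[q,t] below asserts this as well.
  numerator : Series
  numerator = qZeta · denominator height

-- The list at position m holds the coefficients of tᵐ q⁰, tᵐ q¹, ….
ℕ[q,t] : Set
ℕ[q,t] = List (List ℕ)

coeff₁ : List ℕ → ℕ → ℕ
coeff₁ []       _       = 0
coeff₁ (a ∷ _)  zero    = a
coeff₁ (_ ∷ as) (suc n) = coeff₁ as n

coeff : ℕ[q,t] → ℕ → ℕ → ℕ
coeff []       _       _ = 0
coeff (p ∷ _)  zero    n = coeff₁ p n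
coeff (_ ∷ ps) (suc m) n = coeff ps m n

infix 4 _∈ℕ[q,t]
_∈ℕ[q,t] : Series → Set
f ∈ℕ[q,t] = ∃[ h ] ∀ m n → f m n ≡ + coeff h m n

module _ {A : Set} {p} {P : Pred A p} (P? : Decidable P) where

  refineList : List A → List [ x ∈ A ∣ P x ]
  refineList []       = []
  refineList (x ∷ xs) with P? x
  ... | yes px = (x , [ px ]) ∷ refineList xs
  ... | no  _  = refineList xs

  ∈-refineList : ∀ {xs} (z : [ x ∈ A ∣ P x ]) → value z ∈ xs → z ∈ refineList xs
  ∈-refineList {x ∷ xs} (_ , [ pz ]) (here refl) with P? x
  ... | yes _  = here refl
  ... | no ¬px = contradiction (recompute (P? x) pz) ¬px
  ∈-refineList {x ∷ xs} z (there z∈xs) with P? x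
  ... | yes _ = there (∈-refineList z z∈xs)
  ... | no  _ = ∈-refineList z z∈xs

  refineList-≢ : ∀ {xs} z → All.All (value z ≢_) xs → All.All (z ≢_) (refineList xs)
  refineList-≢ {[]}     z []           = []
  refineList-≢ {x ∷ xs} z (z≢x ∷ z≢xs) with P? x
  ... | yes _ = (z≢x ∘ cong value) ∷ refineList-≢ z z≢xs
  ... | no  _ = refineList-≢ z z≢xs

  refineList-unique : ∀ {xs} → Unique xs → Unique (refineList xs)
  refineList-unique {[]}     []           = []
  refineList-unique {x ∷ xs} (x≢xs ∷ xs!) with P? x
  ... | yes px = refineList-≢ (x , [ px ]) x≢xs ∷ refineList-unique xs!
  ... | no  _  = refineList-unique xs!

  refinement-≡ : {y z : [ x ∈ A ∣ P x ]} → value y ≡ value z → y ≡ z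
  refinement-≡ refl = refl

module _ {A : Set} {p} {P : Pred A p} {_≤ᴬ_ : Rel A 0ℓ} (P? : Decidable P)
         (isDPO : IsDecPartialOrder _≡_ _≤ᴬ_) where
  open IsDecPartialOrder isDPO
    using (_≟_; _≤?_; antisym)
    renaming (refl to ≤ᴬ-refl; trans to ≤ᴬ-trans)

  refinement-isDecPartialOrder :
    IsDecPartialOrder {A = [ x ∈ A ∣ P x ]} _≡_ (_≤ᴬ_ on value)
  refinement-isDecPartialOrder = record
    { isPartialOrder = record
      { isPreorder = record
        { isEquivalence = isEquivalence
        ; reflexive     = λ { refl → ≤ᴬ-refl }
        ; trans         = ≤ᴬ-trans
        }
      ; antisym = λ y≤z z≤y → refinement-≡ P? (antisym y≤z z≤y)
      }
    ; _≟_  = λ y z → map′ (refinement-≡ P?) (cong value) (value y ≟ value z)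
    ; _≤?_ = λ y z → value y ≤? value z
    }

module _ (P : FiniteGradedPoset) where
  open FiniteGradedPoset P

  between? : ∀ x y → Decidable (λ z → x ≤ᴾ z × z ≤ᴾ y)
  between? x y z = (x ≤ᴾ? z) ×-dec (z ≤ᴾ? y)

  interval : (x y : Carrier) → x ≤ᴾ y → FiniteGradedPoset
  interval x y x≤y = record
    { Carrier           = I
    ; _≤ᴾ_              = _≤ᴾ_ on value
    ; isDecPartialOrder = refinement-isDecPartialOrder I? isDecPartialOrder
    ; elements          = refineList I? elements
    ; elements-complete = λ z → ∈-refineList I? z (elements-complete (value z))
    ; elements-unique   = refineList-unique I? elements-unique
    ; ⊤                 = y , [ (x≤y , ≤ᴾ-refl) ]
    ; maximum           = λ z → proj₂ (bounds z)
    -- Exact subtraction, since x ≤ᴾ value z.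
    ; rank              = λ z → rank (value z) ∸ rank x
    ; rank-minimal      = λ z z-min → trans
        (cong (λ w → rank (value w) ∸ rank x)
          (sym (z-min (x , [ (≤ᴾ-refl , x≤y) ]) (proj₁ (bounds z)))))
        (ℕ.n∸n≡0 (rank x))
    ; rank-strict       = λ u v u≤v u≢v → ℕ.∸-monoˡ-<
        (rank-strict _ _ u≤v (u≢v ∘ refinement-≡ I?)) (rank≥ u)
    ; rank-cover        = λ u v u⋖v → trans
        (cong (_∸ rank x) (rank-cover _ _ (covers u v u⋖v)))
        (ℕ.+-∸-assoc 1 (rank≥ u))
    }
    where
    I? = between? x y

    I : Set
    I = [ z ∈ Carrier ∣ x ≤ᴾ z × z ≤ᴾ y ]

    bounds : (z : I) → x ≤ᴾ value z × value z ≤ᴾ y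
    bounds (z , [ p ]) = recompute (I? z) p

    rank≥ : (z : I) → rank x ≤ rank (value z)
    rank≥ z = rank-mono _ _ (proj₁ (bounds z))

    covers : (u v : I) → Covers (_≤ᴾ_ on value) u v → Covers _≤ᴾ_ (value u) (value v)
    covers u v (u≤v , u≢v , only) =
        u≤v
      , u≢v ∘ refinement-≡ I?
      , λ z u≤z z≤v → Sum.map (cong value) (cong value)
          (only (z , [ ( ≤ᴾ-trans (proj₁ (bounds u)) u≤z
                       , ≤ᴾ-trans z≤v (proj₂ (bounds v)) ) ]) u≤z z≤v)

-- Rows are indexed by Fin r from 0, so i : Fin r is the row numbered
-- row i = i + 1, and b i is b_{i+1}.  Columns are numbered from 1.
row : ∀ {r} → Fin r → ℕ
row i = suc (toℕ i)

module _ {r : ℕ} (b : Fin r → ℕ) where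

  IsCell : Fin r × ℕ → Set
  IsCell (i , c) = row i ≤ c × c ≤ b i

  isCell? : Decidable IsCell
  isCell? (i , c) = (row i ℕ.≤? c) ×-dec (c ℕ.≤? b i)

  Cell : Set
  Cell = [ ic ∈ Fin r × ℕ ∣ IsCell ic ]

_≤ᶜ_ : ∀ {r} → Rel (Fin r × ℕ) 0ℓ
(i , c) ≤ᶜ (j , d) = row i ≥ row j × c ≤ d

-- The subtraction is exact on cells, where row i ≤ c.
cellRank : ∀ {r} → Fin r × ℕ → ℕ
cellRank (i , c) = c ∸ row i + 1

≤ᶜ-isDecPartialOrder : ∀ {r} → IsDecPartialOrder _≡_ (_≤ᶜ_ {r})
≤ᶜ-isDecPartialOrder = record
  { isPartialOrder = record
    { isPreorder = record
      { isEquivalence = isEquivalence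
      ; reflexive     = λ { refl → ℕ.≤-refl , ℕ.≤-refl }
      ; trans         = λ { (p , q) (p′ , q′) → ℕ.≤-trans p′ p , ℕ.≤-trans q q′ }
      }
    ; antisym = λ { (p , q) (p′ , q′) → cong₂ _,_
        (Fin.toℕ-injective (ℕ.suc-injective (ℕ.≤-antisym p′ p))) (ℕ.≤-antisym q q′) }
    }
  ; _≟_  = Product.≡-dec Fin._≟_ ℕ._≟_
  ; _≤?_ = λ { (i , c) (j , d) → (row j ℕ.≤? row i) ×-dec (c ℕ.≤? d) }
  }

module _ {r : ℕ} (r≥1 : r ≥ 1) (b : Fin r → ℕ)
         (b-decreasing : ∀ i j → i Fin.≤ j → b i ≥ b j)
         (b-diagonal : ∀ i → b i ≥ row i) where

  C : Set
  C = Cell b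

  _≤ᶠ_ : Rel (C ₋) 0ℓ
  _≤ᶠ_ = _≤₋_ (_≤ᶜ_ on value)

  ρ̂ : C ₋ → ℕ
  ρ̂ ⊥₋    = 0
  ρ̂ [ z ] = cellRank (value z)

  isCell : (z : C) → IsCell b (value z)
  isCell (z , [ p ]) = recompute (isCell? b z) p

  cells : List C
  cells = refineList (isCell? b)
    (concatMap (λ i → List.map (i ,_) (upTo (suc (b i)))) (allFin r))

  cells-complete : ∀ z → z ∈ cells
  cells-complete z@((i , c) , _) = ∈-refineList (isCell? b) z
    (∈.∈-concatMap⁺ _ (lose (∈.∈-allFin i)
      (∈.∈-map⁺ (i ,_) (∈.∈-upTo⁺ (s≤s (proj₂ (isCell z)))))))

  cells-unique : Unique cells
  cells-unique = refineList-unique (isCell? b) (Unique.concat⁺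
    (All.map⁺ (All.tabulate λ {i} _ →
      Unique.map⁺ Product.,-injectiveʳ (Unique.upTo⁺ (suc (b i)))))
    (AllPairs.map⁺ (AllPairs.map disjoint (Unique.allFin⁺ r))))
    where
    disjoint : ∀ {i j} → i ≢ j → ∀ {z} →
      ¬ (z ∈ List.map (i ,_) (upTo (suc (b i))) × z ∈ List.map (j ,_) (upTo (suc (b j))))
    disjoint i≢j (p , q) with ∈.∈-map⁻ _ p | ∈.∈-map⁻ _ q
    ... | _ , _ , refl | _ , _ , refl = i≢j refl

  top : Σ[ z ∈ C ] ((w : C) → value w ≤ᶜ value z)
  top = go r≥1 b b-decreasing b-diagonal
    where
    go : ∀ {s} → s ≥ 1 → (b′ : Fin s → ℕ) →
         (∀ i j → i Fin.≤ j → b′ i ≥ b′ j) → (∀ i → b′ i ≥ row i) →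
         Σ[ z ∈ Cell b′ ] ((w : Cell b′) → value w ≤ᶜ value z)
    go {suc s} _ b′ dec diag =
        ((zero , b′ zero) , [ (diag zero , ℕ.≤-refl) ])
      , λ { ((i , c) , [ p ]) →
              s≤s z≤n
            , ℕ.≤-trans (proj₂ (recompute (isCell? b′ (i , c)) p)) (dec zero i z≤n) }

  -- Between u < v there is an element of rank one more than that of u.
  step : ∀ u v → u ≤ᶠ v → u ≢ v → Σ[ w ∈ C ₋ ] (u ≤ᶠ w × w ≤ᶠ v × ρ̂ w ≡ suc (ρ̂ u))
  step ⊥₋ ⊥₋ _ u≢v = contradiction refl u≢v
  step ⊥₋ [ z@((j , d) , _) ] _ _ =
      [ (j , row j) , [ (ℕ.≤-refl , b-diagonal j) ] ]
    , ⊥₋≤ _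
    , [ (ℕ.≤-refl , proj₁ (isCell z)) ]
    , cong (_+ 1) (ℕ.n∸n≡0 (row j))
  step [ y@((i , c) , _) ] [ z@((j , d) , _) ] [ (j≤i , c≤d) ] u≢v
    with ℕ.m≤n⇒m<n∨m≡n j≤i
  ... | inj₂ j≡i with Fin.toℕ-injective {i = j} {j = i} (ℕ.suc-injective j≡i)
  ... | refl with ℕ.m≤n⇒m<n∨m≡n c≤d
  ...   | inj₂ refl = contradiction refl u≢v
  ...   | inj₁ c<d =
      [ (i , suc c) , [ ( ℕ.m≤n⇒m≤1+n (proj₁ (isCell y))
                        , ℕ.≤-trans c<d (proj₂ (isCell z)) ) ] ]
    , [ (ℕ.≤-refl , ℕ.n≤1+n c) ]
    , [ (ℕ.≤-refl , c<d) ]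
    , cong (_+ 1) (ℕ.+-∸-assoc 1 (proj₁ (isCell y)))
  step [ y@((i@(suc i′) , c) , _) ] [ z@((j , d) , _) ] [ (j≤i , c≤d) ] u≢v
      | inj₁ (s≤s j<i) =
      [ (k , c) , [ ( subst (_≤ c) (sym row-k) (ℕ.<⇒≤ i≤c)
                    , ℕ.≤-trans (proj₂ (isCell y)) (b-decreasing k i
                        (ℕ.≤-trans (ℕ.≤-reflexive (Fin.toℕ-inject₁ i′)) (ℕ.n≤1+n _))) ) ] ]
    , [ (subst (_≤ row i) (sym row-k) (ℕ.n≤1+n _) , ℕ.≤-refl) ]
    , [ (subst (row j ≤_) (sym row-k) j<i , c≤d) ]
    , cong (_+ 1) (trans (cong (c ∸_) row-k) (ℕ.+-∸-assoc 1 i≤c))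
    where
    k = inject₁ i′

    row-k : row k ≡ toℕ i
    row-k = cong suc (Fin.toℕ-inject₁ i′)

    i≤c : row i ≤ c
    i≤c = proj₁ (isCell y)

  strict : ∀ u v → u ≤ᶠ v → u ≢ v → ρ̂ u < ρ̂ v
  strict u v u≤v u≢v with step u v u≤v u≢v
  ... | w , _ , w≤v , ρw = subst (_≤ ρ̂ v) ρw (mono w≤v)
    where
    mono : ∀ {u v} → u ≤ᶠ v → ρ̂ u ≤ ρ̂ v
    mono (⊥₋≤ _)       = z≤n
    mono [ (p , q) ] = ℕ.+-monoˡ-≤ 1 (ℕ.∸-mono q p)

  cover : ∀ u v → Covers _≤ᶠ_ u v → ρ̂ v ≡ suc (ρ̂ u)
  cover u v (u≤v , u≢v , only) with step u v u≤v u≢v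
  ... | w , u≤w , w≤v , ρw with only w u≤w w≤v
  ...   | inj₁ refl = contradiction ρw (ℕ.<⇒≢ ℕ.≤-refl)
  ...   | inj₂ refl = ρw

  -- _₋ adjoins a new minimum ⊥₋ to the cells.
  F̂ : FiniteGradedPoset
  F̂ = record
    { Carrier           = C ₋
    ; _≤ᴾ_              = _≤ᶠ_
    ; isDecPartialOrder = ≤₋-isDecPartialOrder-≡ _
        (refinement-isDecPartialOrder (isCell? b) ≤ᶜ-isDecPartialOrder)
    ; elements          = ⊥₋ ∷ List.map [_] cells
    ; elements-complete = λ { ⊥₋    → here refl
                            ; [ z ] → there (∈.∈-map⁺ [_] (cells-complete z)) }
    ; elements-unique   = All.map⁺ (All.tabulate λ _ ())
                        ∷ Unique.map⁺ (λ { refl → refl }) cells-unique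
    ; ⊤                 = [ proj₁ top ]
    ; maximum           = λ { ⊥₋ → ⊥₋≤ _ ; [ z ] → [ proj₂ top z ] }
    ; rank              = ρ̂
    ; rank-minimal      = λ x x-min → cong ρ̂ (sym (x-min ⊥₋ (⊥₋≤ x)))
    ; rank-strict       = strict
    ; rank-cover        = cover
    }

{-# OPTIONS --safe #-}
module Submission where

-- Let Z_z be the zeta series of the principal ideal of z, and N_z its
-- numerator over the denominator of length ρ(z).  Splitting off the last
-- element of a chain gives (1 - q^ρ(z) t) Z_z = 1 + t Σ_{w<z} q^ρ(w) Z_w.  In
-- F̂ and in its intervals an element z has at most two lower covers.  With a
-- single lower cover w this says N_z = N_w; with two, w₁ and w₂, whose meet
-- w₃ has rank ρ(w₁) - 1, inclusion-exclusion turns it into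
--   N_z = N_{w₁} + (N_{w₂} - N_{w₃}) + q^ρ(w₁) t N_{w₃}.
-- By induction on the rank, N_z is a polynomial, has nonnegative
-- coefficients, and is coefficientwise monotone in z.

open import Defs
open import Data.Bool.Base using (Bool; if_then_else_)
open import Data.Fin.Base as Fin using (Fin; toℕ; fromℕ<)
import Data.Fin.Properties as Fin
open import Data.Integer.Base as ℤ using (ℤ; +_; 0ℤ; 1ℤ; ∣_∣)
import Data.Integer.Properties as ℤ
open import Data.Integer.Tactic.RingSolver using (solve-∀)
open import Data.Irrelevant using ([_])
open import Data.List.Base as List
  using (List; []; _∷_; _++_; applyUpTo; filter; foldr; cartesianProductWith)
open import Data.List.Membership.Propositional using (_∈_)
open import Data.List.Relation.Unary.All as All using (All; []; _∷_)
open import Data.List.Relation.Unary.Any using (here; there)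
open import Data.List.Relation.Unary.Unique.Propositional using (Unique; []; _∷_)
open import Data.Nat.Base
  using (ℕ; zero; suc; _+_; _∸_; _≤_; _<_; _≥_; _⊔_; z≤n; s≤s)
import Data.Nat.Properties as ℕ
open import Data.Product.Base using (∃-syntax; _×_; _,_; proj₁; proj₂)
open import Data.Refinement.Base using (_,_; value)
open import Data.Sum.Base as Sum using (_⊎_; inj₁; inj₂)
open import Data.Vec.Base using (Vec; []; _∷_)
open import Data.Vec.Relation.Unary.Linked as Linked
  using (Linked; linked?; []; [-]; _∷_)
open import Function.Base using (_∘_; id)
open import Function.Bundles using (mk⇔)
open import Relation.Binary.Construct.Add.Infimum.NonStrict using (⊥₋≤_; [_])
open import Relation.Binary.Definitions using (Minimum)
open import Relation.Binary.PropositionalEquality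
open import Relation.Binary.Structures using (IsDecPartialOrder)
open import Relation.Nullary
  using (Dec; does; yes; no; contradiction; ¬_; recompute; _×-dec_)
open import Relation.Nullary.Construct.Add.Infimum using (⊥₋; [_])
open import Relation.Nullary.Decidable using (does-⇔)
open import Relation.Unary using (Pred; Decidable)

open import Algebra.Properties.Semiring.Sum ℤ.+-*-semiring
  using (sum⁺-syntax; sum-cong-≗; ∑-distrib-+)

open ≡-Reasoning

-- The obstacle is the term -N_{w₃}: nonnegativity of the smaller numerators says nothing about its
-- size, so nonnegativity alone does not pass from the lower covers to z. Monotonicity does, because
-- the recursion can be read in two ways: N_{w₂} - N_{w₃} ≥ 0 gives N_z ≥ N_{w₁}, and N_{w₁} -
-- N_{w₃} ≥ 0 gives N_z ≥ N_{w₂}. All that enters about F̂ is the shape of the set of elements below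
-- each z, recorded in `LowerCovers`. That condition is inherited by intervals, so the induction
-- runs in any finite graded poset that has a minimum and satisfies it. The adjoined 0̂ makes the
-- condition hold near the diagonal: the cells (i,i) and (i+1,i+1) are both covered by (i,i+1), when
-- it and (i+1,i+1) exist, and have no common lower bound among the cells.

-- Shifts and products of series

-- q^a · f in ℤ[[q]]
qShift : ℕ → (ℕ → ℤ) → ℕ → ℤ
qShift zero    f n       = f n
qShift (suc a) f zero    = 0ℤ
qShift (suc a) f (suc n) = qShift a f n

qShift-cong : ∀ a {f g} → f ≗ g → qShift a f ≗ qShift a g
qShift-cong zero    f≗g n       = f≗g n
qShift-cong (suc a) f≗g zero    = refl
qShift-cong (suc a) f≗g (suc n) = qShift-cong a f≗g n

qShift-0 : ∀ a n → qShift a (λ _ → 0ℤ) n ≡ 0ℤ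
qShift-0 zero    n       = refl
qShift-0 (suc a) zero    = refl
qShift-0 (suc a) (suc n) = qShift-0 a n

qShift-+ : ∀ a f g n → qShift a (λ k → f k ℤ.+ g k) n ≡ qShift a f n ℤ.+ qShift a g n
qShift-+ zero    f g n       = refl
qShift-+ (suc a) f g zero    = refl
qShift-+ (suc a) f g (suc n) = qShift-+ a f g n

qShift-* : ∀ a c f n → qShift a (λ k → c ℤ.* f k) n ≡ c ℤ.* qShift a f n
qShift-* zero    c f n       = refl
qShift-* (suc a) c f zero    = sym (ℤ.*-zeroʳ c)
qShift-* (suc a) c f (suc n) = qShift-* a c f n

qShift-∘ : ∀ a b f n → qShift a (qShift b f) n ≡ qShift (a + b) f n
qShift-∘ zero    b f n       = refl
qShift-∘ (suc a) b f zero    = refl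
qShift-∘ (suc a) b f (suc n) = qShift-∘ a b f n

qShift-comm : ∀ a b f n → qShift a (qShift b f) n ≡ qShift b (qShift a f) n
qShift-comm a b f n = begin
  qShift a (qShift b f) n ≡⟨ qShift-∘ a b f n ⟩
  qShift (a + b) f n      ≡⟨ cong (λ c → qShift c f n) (ℕ.+-comm a b) ⟩
  qShift (b + a) f n      ≡⟨ qShift-∘ b a f n ⟨
  qShift b (qShift a f) n ∎

qShift-q^ : ∀ a b n → qShift a (q^ b) n ≡ (q^ (a + b)) n
qShift-q^ zero    b n       = refl
qShift-q^ (suc a) b zero    = refl
qShift-q^ (suc a) b (suc n) = qShift-q^ a b n

qShift-nonneg : ∀ a {f} → (∀ n → 0ℤ ℤ.≤ f n) → ∀ n → 0ℤ ℤ.≤ qShift a f n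
qShift-nonneg zero    f≥0 n       = f≥0 n
qShift-nonneg (suc a) f≥0 zero    = ℤ.≤-refl
qShift-nonneg (suc a) f≥0 (suc n) = qShift-nonneg a f≥0 n

qShift-vanish : ∀ a {f B} → (∀ n → B ≤ n → f n ≡ 0ℤ) →
                ∀ n → a + B ≤ n → qShift a f n ≡ 0ℤ
qShift-vanish zero    f≡0 n       B≤n       = f≡0 n B≤n
qShift-vanish (suc a) f≡0 (suc n) (s≤s B≤n) = qShift-vanish a f≡0 n B≤n

infixl 7 _⊛_
-- The inner sum of `_·_`: by definition `(f · g) m n` is the sum over i ≤ m of
-- `(f i ⊛ g (m ∸ i)) n`. Laws of `_·_` are therefore laws of `_⊛_` lifted through one more sum.
_⊛_ : (ℕ → ℤ) → (ℕ → ℤ) → ℕ → ℤ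
(f ⊛ g) n = ∑[ j ≤ n ] (f (toℕ j) ℤ.* g (n ∸ toℕ j))

⊛-cong : ∀ {f f′ g g′} → f ≗ f′ → g ≗ g′ → f ⊛ g ≗ f′ ⊛ g′
⊛-cong f≗f′ g≗g′ n =
  sum-cong-≗ {suc n} λ j → cong₂ ℤ._*_ (f≗f′ (toℕ j)) (g≗g′ (n ∸ toℕ j))

⊛-zeroˡ : ∀ g n → ((λ _ → 0ℤ) ⊛ g) n ≡ 0ℤ
⊛-zeroˡ g zero    = refl
⊛-zeroˡ g (suc n) = trans (ℤ.+-identityˡ _) (⊛-zeroˡ g n)

⊛-zeroʳ : ∀ f n → (f ⊛ (λ _ → 0ℤ)) n ≡ 0ℤ
⊛-zeroʳ f zero    = trans (ℤ.+-identityʳ _) (ℤ.*-zeroʳ (f 0))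
⊛-zeroʳ f (suc n) = cong₂ ℤ._+_ (ℤ.*-zeroʳ (f 0)) (⊛-zeroʳ (f ∘ suc) n)

⊛-distribʳ-+ : ∀ f g h n →
               ((λ k → f k ℤ.+ g k) ⊛ h) n ≡ (f ⊛ h) n ℤ.+ (g ⊛ h) n
⊛-distribʳ-+ f g h n = trans
  (sum-cong-≗ {suc n} λ j →
    ℤ.*-distribʳ-+ (h (n ∸ toℕ j)) (f (toℕ j)) (g (toℕ j)))
  (∑-distrib-+ {suc n} (λ j → f (toℕ j) ℤ.* h (n ∸ toℕ j))
                       (λ j → g (toℕ j) ℤ.* h (n ∸ toℕ j)))

⊛-distribˡ-+ : ∀ f g h n →
               (f ⊛ (λ k → g k ℤ.+ h k)) n ≡ (f ⊛ g) n ℤ.+ (f ⊛ h) n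
⊛-distribˡ-+ f g h n = trans
  (sum-cong-≗ {suc n} λ j →
    ℤ.*-distribˡ-+ (f (toℕ j)) (g (n ∸ toℕ j)) (h (n ∸ toℕ j)))
  (∑-distrib-+ {suc n} (λ j → f (toℕ j) ℤ.* g (n ∸ toℕ j))
                       (λ j → f (toℕ j) ℤ.* h (n ∸ toℕ j)))

⊛-qShiftˡ : ∀ a f g → qShift a f ⊛ g ≗ qShift a (f ⊛ g)
⊛-qShiftˡ zero    f g n       = refl
⊛-qShiftˡ (suc a) f g zero    = refl
⊛-qShiftˡ (suc a) f g (suc n) = trans (ℤ.+-identityˡ _) (⊛-qShiftˡ a f g n)

⊛-qShiftʳ : ∀ a f g → f ⊛ qShift a g ≗ qShift a (f ⊛ g)
⊛-qShiftʳ zero    f g n    = refl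
⊛-qShiftʳ (suc a) f g zero = trans (ℤ.+-identityʳ _) (ℤ.*-zeroʳ (f 0))
⊛-qShiftʳ (suc a) f g (suc n) = trans (unit f n) (⊛-qShiftʳ a f g n)
  where
  -- On this side the vanishing summand is the last one of the sum, so it is reached only by
  -- induction on n, with f replaced by its tail.
  unit : ∀ f n → (f ⊛ qShift (suc a) g) (suc n) ≡ (f ⊛ qShift a g) n
  unit f zero    = cong (λ x → f 0 ℤ.* qShift a g 0 ℤ.+ x)
                     (trans (ℤ.+-identityʳ _) (ℤ.*-zeroʳ (f 1)))
  unit f (suc n) = cong (λ x → f 0 ℤ.* qShift a g (suc n) ℤ.+ x) (unit (f ∘ suc) n)

⊛-identityʳ : ∀ f → f ⊛ q^ 0 ≗ f
⊛-identityʳ f zero    = trans (ℤ.+-identityʳ _) (ℤ.*-identityʳ (f 0))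
⊛-identityʳ f (suc n) =
  trans (cong₂ ℤ._+_ (ℤ.*-zeroʳ (f 0)) (⊛-identityʳ (f ∘ suc) n)) (ℤ.+-identityˡ _)

-- Series in t and q, and multiplication by 1 - q^a t

infix 4 _≈_
_≈_ : Series → Series → Set
f ≈ g = ∀ m n → f m n ≡ g m n

infixl 6 _⊕_ _⊖_
_⊕_ _⊖_ : Series → Series → Series
(f ⊕ g) m n = f m n ℤ.+ g m n
(f ⊖ g) m n = f m n ℤ.- g m n

1# : Series
1# zero    = q^ 0
1# (suc _) = λ _ → 0ℤ

-- q^a t · f
shift : ℕ → Series → Series
shift a f zero    n = 0ℤ
shift a f (suc m) n = qShift a (f m) n

shift-cong : ∀ a {f g} → f ≈ g → shift a f ≈ shift a g
shift-cong a f≈g zero    n = refl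
shift-cong a f≈g (suc m) n = qShift-cong a (f≈g m) n

shift-nonneg : ∀ a {f} → (∀ m n → 0ℤ ℤ.≤ f m n) → ∀ m n → 0ℤ ℤ.≤ shift a f m n
shift-nonneg a f≥0 zero    n = ℤ.≤-refl
shift-nonneg a f≥0 (suc m) n = qShift-nonneg a (f≥0 m) n

·-cong : ∀ {f f′ g g′} → f ≈ f′ → g ≈ g′ → f · g ≈ f′ · g′
·-cong f≈f′ g≈g′ m n =
  sum-cong-≗ {suc m} λ i → ⊛-cong (f≈f′ (toℕ i)) (g≈g′ (m ∸ toℕ i)) n

·-distribʳ-⊕ : ∀ f g h → (f ⊕ g) · h ≈ f · h ⊕ g · h
·-distribʳ-⊕ f g h m n = trans
  (sum-cong-≗ {suc m} λ i → ⊛-distribʳ-+ (f (toℕ i)) (g (toℕ i)) (h (m ∸ toℕ i)) n)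
  (∑-distrib-+ {suc m} (λ i → (f (toℕ i) ⊛ h (m ∸ toℕ i)) n)
                       (λ i → (g (toℕ i) ⊛ h (m ∸ toℕ i)) n))

·-distribˡ-⊕ : ∀ f g h → f · (g ⊕ h) ≈ f · g ⊕ f · h
·-distribˡ-⊕ f g h m n = trans
  (sum-cong-≗ {suc m} λ i → ⊛-distribˡ-+ (f (toℕ i)) (g (m ∸ toℕ i)) (h (m ∸ toℕ i)) n)
  (∑-distrib-+ {suc m} (λ i → (f (toℕ i) ⊛ g (m ∸ toℕ i)) n)
                       (λ i → (f (toℕ i) ⊛ h (m ∸ toℕ i)) n))

⊖-⊕-cancel : ∀ f g → (f ⊖ g) ⊕ g ≈ f
⊖-⊕-cancel f g m n = lemma (f m n) (g m n)
  where
  lemma : ∀ x y → (x ℤ.- y) ℤ.+ y ≡ x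
  lemma = solve-∀

x+y≡z⇒x≡z-y : ∀ {x y z} → x ℤ.+ y ≡ z → x ≡ z ℤ.- y
x+y≡z⇒x≡z-y {x} {y} refl = lemma x y
  where
  lemma : ∀ x y → x ≡ (x ℤ.+ y) ℤ.- y
  lemma = solve-∀

-- Multiply out (f ⊖ g) ⊕ g ≈ f by additivity and move the second product across.
·-distribʳ-⊖ : ∀ f g h → (f ⊖ g) · h ≈ f · h ⊖ g · h
·-distribʳ-⊖ f g h m n = x+y≡z⇒x≡z-y (trans
  (sym (·-distribʳ-⊕ (f ⊖ g) g h m n))
  (·-cong {g = h} (⊖-⊕-cancel f g) (λ _ _ → refl) m n))

·-distribˡ-⊖ : ∀ f g h → f · (g ⊖ h) ≈ f · g ⊖ f · h
·-distribˡ-⊖ f g h m n = x+y≡z⇒x≡z-y (trans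
  (sym (·-distribˡ-⊕ f (g ⊖ h) h m n))
  (·-cong {f} (λ _ _ → refl) (⊖-⊕-cancel g h) m n))

·-shiftˡ : ∀ a f g → shift a f · g ≈ shift a (f · g)
·-shiftˡ a f g zero    n = trans (ℤ.+-identityʳ _) (⊛-zeroˡ (g 0) n)
·-shiftˡ a f g (suc m) n =
  trans (cong₂ ℤ._+_ (⊛-zeroˡ (g (suc m)) n) (aux f m n)) (ℤ.+-identityˡ _)
  where
  aux : ∀ f m n → ((λ i → qShift a (f i)) · g) m n ≡ qShift a ((f · g) m) n
  aux f zero    n = begin
    (qShift a (f 0) ⊛ g 0) n ℤ.+ 0ℤ         ≡⟨ ℤ.+-identityʳ _ ⟩
    (qShift a (f 0) ⊛ g 0) n                ≡⟨ ⊛-qShiftˡ a (f 0) (g 0) n ⟩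
    qShift a (f 0 ⊛ g 0) n                  ≡⟨ qShift-cong a (λ _ → sym (ℤ.+-identityʳ _)) n ⟩
    qShift a (λ k → (f 0 ⊛ g 0) k ℤ.+ 0ℤ) n ∎
  aux f (suc m) n = begin
    (qShift a (f 0) ⊛ g (suc m)) n ℤ.+ ((λ i → qShift a (f (suc i))) · g) m n
      ≡⟨ cong₂ ℤ._+_ (⊛-qShiftˡ a (f 0) (g (suc m)) n) (aux (f ∘ suc) m n) ⟩
    qShift a (f 0 ⊛ g (suc m)) n ℤ.+ qShift a ((f ∘ suc · g) m) n
      ≡⟨ qShift-+ a (f 0 ⊛ g (suc m)) ((f ∘ suc · g) m) n ⟨
    qShift a ((f · g) (suc m)) n ∎

·-shiftʳ : ∀ a f g → f · shift a g ≈ shift a (f · g)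
·-shiftʳ a f g zero    n = trans (ℤ.+-identityʳ _) (⊛-zeroʳ (f 0) n)
·-shiftʳ a f g (suc m) n = aux f m n
  where
  aux : ∀ f m n → (f · shift a g) (suc m) n ≡ qShift a ((f · g) m) n
  aux f zero n = begin
    (f 0 ⊛ qShift a (g 0)) n ℤ.+ ((f 1 ⊛ (λ _ → 0ℤ)) n ℤ.+ 0ℤ)
      ≡⟨ cong₂ ℤ._+_ (⊛-qShiftʳ a (f 0) (g 0) n)
           (trans (ℤ.+-identityʳ _) (⊛-zeroʳ (f 1) n)) ⟩
    qShift a (f 0 ⊛ g 0) n ℤ.+ 0ℤ
      ≡⟨ ℤ.+-identityʳ _ ⟩
    qShift a (f 0 ⊛ g 0) n
      ≡⟨ qShift-cong a (λ _ → sym (ℤ.+-identityʳ _)) n ⟩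
    qShift a (λ k → (f 0 ⊛ g 0) k ℤ.+ 0ℤ) n ∎
  aux f (suc m) n = begin
    (f 0 ⊛ qShift a (g (suc m))) n ℤ.+ (f ∘ suc · shift a g) (suc m) n
      ≡⟨ cong₂ ℤ._+_ (⊛-qShiftʳ a (f 0) (g (suc m)) n) (aux (f ∘ suc) m n) ⟩
    qShift a (f 0 ⊛ g (suc m)) n ℤ.+ qShift a ((f ∘ suc · g) m) n
      ≡⟨ qShift-+ a (f 0 ⊛ g (suc m)) ((f ∘ suc · g) m) n ⟨
    qShift a ((f · g) (suc m)) n ∎

·-identityʳ : ∀ f → f · 1# ≈ f
·-identityʳ f zero    n = trans (ℤ.+-identityʳ _) (⊛-identityʳ (f 0) n)
·-identityʳ f (suc m) n =
  trans (cong₂ ℤ._+_ (⊛-zeroʳ (f 0) n) (·-identityʳ (f ∘ suc) m n)) (ℤ.+-identityˡ _)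

-- (1 - q^a t) · f
factor : ℕ → Series → Series
factor a f = f ⊖ shift a f

1-q^t≈factor : ∀ a → 1-q^ a t ≈ factor a 1#
1-q^t≈factor a 0             n = sym (ℤ.+-identityʳ _)
1-q^t≈factor a 1             n = begin
  ℤ.- (q^ a) n                ≡⟨ cong (λ b → ℤ.- (q^ b) n) (ℕ.+-identityʳ a) ⟨
  ℤ.- (q^ (a + 0)) n          ≡⟨ cong ℤ.-_ (qShift-q^ a 0 n) ⟨
  ℤ.- qShift a (q^ 0) n       ≡⟨ ℤ.+-identityˡ _ ⟨
  0ℤ ℤ.- qShift a (q^ 0) n    ∎
1-q^t≈factor a (suc (suc _)) n = sym (cong (λ x → 0ℤ ℤ.- x) (qShift-0 a n))

factor-cong : ∀ a {f g} → f ≈ g → factor a f ≈ factor a g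
factor-cong a f≈g m n = cong₂ ℤ._-_ (f≈g m n) (shift-cong a f≈g m n)

·-factorˡ : ∀ a f g → factor a f · g ≈ factor a (f · g)
·-factorˡ a f g m n =
  trans (·-distribʳ-⊖ f (shift a f) g m n) (cong (λ x → (f · g) m n ℤ.- x) (·-shiftˡ a f g m n))

·-factorʳ : ∀ a f g → f · factor a g ≈ factor a (f · g)
·-factorʳ a f g m n =
  trans (·-distribˡ-⊖ f g (shift a g) m n) (cong (λ x → (f · g) m n ℤ.- x) (·-shiftʳ a f g m n))

·-1-q^t : ∀ a f → f · 1-q^ a t ≈ factor a f
·-1-q^t a f m n = begin
  (f · 1-q^ a t) m n          ≡⟨ ·-cong {f} (λ _ _ → refl) (1-q^t≈factor a) m n ⟩
  (f · factor a 1#) m n       ≡⟨ ·-factorʳ a f 1# m n ⟩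
  factor a (f · 1#) m n       ≡⟨ factor-cong a (·-identityʳ f) m n ⟩
  factor a f m n              ∎

-- Multiplication by 1 - q^a t is a difference of shifts, and shifts pull out of either argument of
-- a product. This takes the place of associativity and commutativity of `_·_` when the last factor
-- is carried from the denominator over to f.
·-denominator : ∀ k f → f · denominator (suc k) ≈ factor (suc k) f · denominator k
·-denominator k f m n = begin
  (f · denominator (suc k)) m n
    ≡⟨ ·-cong {f} (λ _ _ → refl) (·-1-q^t (suc k) (denominator k)) m n ⟩
  (f · factor (suc k) (denominator k)) m n
    ≡⟨ ·-factorʳ (suc k) f (denominator k) m n ⟩
  factor (suc k) (f · denominator k) m n
    ≡⟨ ·-factorˡ (suc k) f (denominator k) m n ⟨
  (factor (suc k) f · denominator k) m n ∎

-- Sums over lists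

indicator : Bool → ℤ
indicator b = if b then 1ℤ else 0ℤ

-- Only the Boolean part of the decision enters, so decisions of equivalent propositions get equal
-- values. Conditions on chains thereby become weights in sums over all elements, where the order of
-- summation may be changed freely.
⟦_⟧ : ∀ {p} {P : Set p} → Dec P → ℤ
⟦ P? ⟧ = indicator (does P?)

⟦⟧-cong : ∀ {p q} {P : Set p} {Q : Set q} (P? : Dec P) (Q? : Dec Q) →
          (P → Q) → (Q → P) → ⟦ P? ⟧ ≡ ⟦ Q? ⟧
⟦⟧-cong P? Q? f g = cong indicator (does-⇔ (mk⇔ f g) P? Q?)

⟦⟧-× : ∀ {p q} {P : Set p} {Q : Set q} (P? : Dec P) (Q? : Dec Q) →
       ⟦ P? ×-dec Q? ⟧ ≡ ⟦ P? ⟧ ℤ.* ⟦ Q? ⟧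
⟦⟧-× (yes _) (yes _) = refl
⟦⟧-× (yes _) (no _)  = refl
⟦⟧-× (no _)  (yes _) = refl
⟦⟧-× (no _)  (no _)  = refl

module _ {A : Set} where

  ∑ᴸ : List A → (A → ℤ) → ℤ
  ∑ᴸ xs f = foldr ℤ._+_ 0ℤ (List.map f xs)

  ∑ᴸ-cong : ∀ xs {f g : A → ℤ} → f ≗ g → ∑ᴸ xs f ≡ ∑ᴸ xs g
  ∑ᴸ-cong []       f≗g = refl
  ∑ᴸ-cong (x ∷ xs) f≗g = cong₂ ℤ._+_ (f≗g x) (∑ᴸ-cong xs f≗g)

  ∑ᴸ-0 : ∀ xs → ∑ᴸ xs (λ _ → 0ℤ) ≡ 0ℤ
  ∑ᴸ-0 []       = refl
  ∑ᴸ-0 (x ∷ xs) = trans (ℤ.+-identityˡ _) (∑ᴸ-0 xs)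

  ∑ᴸ-+ : ∀ xs (f g : A → ℤ) → ∑ᴸ xs (λ x → f x ℤ.+ g x) ≡ ∑ᴸ xs f ℤ.+ ∑ᴸ xs g
  ∑ᴸ-+ []       f g = refl
  ∑ᴸ-+ (x ∷ xs) f g =
    trans (cong (λ s → f x ℤ.+ g x ℤ.+ s) (∑ᴸ-+ xs f g)) (lemma (f x) (g x) _ _)
    where
    lemma : ∀ a b c d → (a ℤ.+ b) ℤ.+ (c ℤ.+ d) ≡ (a ℤ.+ c) ℤ.+ (b ℤ.+ d)
    lemma = solve-∀

  *-distribˡ-∑ᴸ : ∀ c xs (f : A → ℤ) → c ℤ.* ∑ᴸ xs f ≡ ∑ᴸ xs (λ x → c ℤ.* f x)
  *-distribˡ-∑ᴸ c []       f = ℤ.*-zeroʳ c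
  *-distribˡ-∑ᴸ c (x ∷ xs) f =
    trans (ℤ.*-distribˡ-+ c (f x) _) (cong (λ s → c ℤ.* f x ℤ.+ s) (*-distribˡ-∑ᴸ c xs f))

  qShift-∑ᴸ : ∀ a xs (f : A → ℕ → ℤ) n →
              qShift a (λ k → ∑ᴸ xs (λ x → f x k)) n ≡ ∑ᴸ xs (λ x → qShift a (f x) n)
  qShift-∑ᴸ a []       f n = qShift-0 a n
  qShift-∑ᴸ a (x ∷ xs) f n =
    trans (qShift-+ a (f x) _ n) (cong (λ s → qShift a (f x) n ℤ.+ s) (qShift-∑ᴸ a xs f n))

  ∑ᴸ-++ : ∀ xs ys (f : A → ℤ) → ∑ᴸ (xs ++ ys) f ≡ ∑ᴸ xs f ℤ.+ ∑ᴸ ys f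
  ∑ᴸ-++ []       ys f = sym (ℤ.+-identityˡ _)
  ∑ᴸ-++ (x ∷ xs) ys f =
    trans (cong (λ s → f x ℤ.+ s) (∑ᴸ-++ xs ys f)) (sym (ℤ.+-assoc (f x) _ _))

  ∑ᴸ-filter : ∀ {p} {P : Pred A p} (P? : Decidable P) xs (f : A → ℤ) →
              ∑ᴸ (filter P? xs) f ≡ ∑ᴸ xs (λ x → ⟦ P? x ⟧ ℤ.* f x)
  ∑ᴸ-filter P? []       f = refl
  ∑ᴸ-filter P? (x ∷ xs) f with P? x
  ... | yes _ = cong₂ ℤ._+_ (sym (ℤ.*-identityˡ (f x))) (∑ᴸ-filter P? xs f)
  ... | no _  = trans (∑ᴸ-filter P? xs f) (sym (ℤ.+-identityˡ _))

  ∑ᴸ-select : (_≟_ : (x y : A) → Dec (x ≡ y)) → ∀ {xs z} → Unique xs → z ∈ xs →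
              (f : A → ℤ) → ∑ᴸ xs (λ x → ⟦ x ≟ z ⟧ ℤ.* f x) ≡ f z
  ∑ᴸ-select _≟_ {x ∷ xs} {z} (x∉xs ∷ _) (here refl) f = begin
    ⟦ x ≟ x ⟧ ℤ.* f x ℤ.+ ∑ᴸ xs (λ y → ⟦ y ≟ x ⟧ ℤ.* f y)
      ≡⟨ cong₂ ℤ._+_ (cong (λ i → i ℤ.* f x) (⟦⟧-cong (x ≟ x) (yes refl) id id))
                     (rest x∉xs) ⟩
    1ℤ ℤ.* f x ℤ.+ 0ℤ
      ≡⟨ trans (ℤ.+-identityʳ _) (ℤ.*-identityˡ (f x)) ⟩
    f x ∎
    where
    rest : ∀ {xs} → All (x ≢_) xs → ∑ᴸ xs (λ y → ⟦ y ≟ x ⟧ ℤ.* f y) ≡ 0ℤ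
    rest [] = refl
    rest {y ∷ xs} (x≢y ∷ p) with y ≟ x
    ... | yes refl = contradiction refl x≢y
    ... | no _ = trans (ℤ.+-identityˡ _) (rest p)
  ∑ᴸ-select _≟_ {x ∷ xs} {z} (x∉xs ∷ xs!) (there z∈xs) f with x ≟ z
  ... | yes refl = contradiction refl (All.lookup x∉xs z∈xs)
  ... | no _ = trans (ℤ.+-identityˡ _) (∑ᴸ-select _≟_ xs! z∈xs f)

∑ᴸ-swap : ∀ {A B : Set} xs ys (f : A → B → ℤ) →
          ∑ᴸ xs (λ x → ∑ᴸ ys (f x)) ≡ ∑ᴸ ys (λ y → ∑ᴸ xs (λ x → f x y))
∑ᴸ-swap []       ys f = sym (∑ᴸ-0 ys)
∑ᴸ-swap (x ∷ xs) ys f =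
  trans (cong (λ s → ∑ᴸ ys (f x) ℤ.+ s) (∑ᴸ-swap xs ys f))
        (sym (∑ᴸ-+ ys (f x) (λ y → ∑ᴸ xs (λ x → f x y))))

∑ᴸ-map : ∀ {A B : Set} (g : A → B) xs (f : B → ℤ) → ∑ᴸ (List.map g xs) f ≡ ∑ᴸ xs (f ∘ g)
∑ᴸ-map g []       f = refl
∑ᴸ-map g (x ∷ xs) f = cong (λ s → f (g x) ℤ.+ s) (∑ᴸ-map g xs f)

∑ᴸ-cartesianProductWith :
  ∀ {A B C : Set} (g : A → B → C) xs ys (f : C → ℤ) →
  ∑ᴸ (cartesianProductWith g xs ys) f ≡ ∑ᴸ xs (λ x → ∑ᴸ ys (λ y → f (g x y)))
∑ᴸ-cartesianProductWith g []       ys f = refl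
∑ᴸ-cartesianProductWith g (x ∷ xs) ys f =
  trans (∑ᴸ-++ (List.map (g x) ys) (cartesianProductWith g xs ys) f)
        (cong₂ ℤ._+_ (∑ᴸ-map (g x) ys f) (∑ᴸ-cartesianProductWith g xs ys f))

∑ᴸ-distribʳ : ∀ {A : Set} xs (a b g : A → ℤ) →
  ∑ᴸ xs (λ x → (a x ℤ.+ b x) ℤ.* g x) ≡
  ∑ᴸ xs (λ x → a x ℤ.* g x) ℤ.+ ∑ᴸ xs (λ x → b x ℤ.* g x)
∑ᴸ-distribʳ xs a b g = trans
  (∑ᴸ-cong xs λ x → ℤ.*-distribʳ-+ (g x) (a x) (b x))
  (∑ᴸ-+ xs (λ x → a x ℤ.* g x) (λ x → b x ℤ.* g x))

-- Polynomials with nonnegative coefficients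

NonNegative : Series → Set
NonNegative f = ∀ m n → 0ℤ ℤ.≤ f m n

infix 4 _≼_
_≼_ : Series → Series → Set
f ≼ g = ∀ m n → f m n ℤ.≤ g m n

FinitelySupported : Series → Set
FinitelySupported f = ∃[ B ] ∀ m n → B ≤ m ⊎ B ≤ n → f m n ≡ 0ℤ

1#-finitelySupported : FinitelySupported 1#
1#-finitelySupported = 1 , λ where
  zero    zero    (inj₁ ())
  zero    zero    (inj₂ ())
  zero    (suc _) _ → refl
  (suc _) _       _ → refl

≈-finitelySupported : ∀ {f g} → f ≈ g → FinitelySupported g → FinitelySupported f
≈-finitelySupported f≈g (B , g≡0) = B , λ m n out → trans (f≈g m n) (g≡0 m n out)

zip-finitelySupported : (_∙_ : ℤ → ℤ → ℤ) → 0ℤ ∙ 0ℤ ≡ 0ℤ → ∀ {f g} →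
  FinitelySupported f → FinitelySupported g → FinitelySupported (λ m n → f m n ∙ g m n)
zip-finitelySupported _∙_ 0∙0 (B , f≡0) (B′ , g≡0) = B ⊔ B′ , λ m n out → trans
  (cong₂ _∙_ (f≡0 m n (Sum.map (ℕ.m⊔n≤o⇒m≤o B B′) (ℕ.m⊔n≤o⇒m≤o B B′) out))
             (g≡0 m n (Sum.map (ℕ.m⊔n≤o⇒n≤o B B′) (ℕ.m⊔n≤o⇒n≤o B B′) out)))
  0∙0

shift-finitelySupported : ∀ a {f} → FinitelySupported f → FinitelySupported (shift a f)
-- The exponent of t grows by 1 and that of q by a; one bound has to serve for both.
shift-finitelySupported a {f} (B , f≡0) = suc (a + B) , λ where
  zero    n _                    → refl
  (suc m) n (inj₁ (s≤s a+B≤m))   → trans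
    (qShift-cong a (λ k → f≡0 m k (inj₁ (ℕ.≤-trans (ℕ.m≤n+m B a) a+B≤m))) n)
    (qShift-0 a n)
  (suc m) n (inj₂ a+B<n)         →
    qShift-vanish a (λ k B≤k → f≡0 m k (inj₂ B≤k)) n (ℕ.<⇒≤ a+B<n)

coeff₁-applyUpTo : ∀ f B n → (B ≤ n → f n ≡ 0) → coeff₁ (applyUpTo f B) n ≡ f n
coeff₁-applyUpTo f zero    n       f≡0 = sym (f≡0 z≤n)
coeff₁-applyUpTo f (suc B) zero    f≡0 = refl
coeff₁-applyUpTo f (suc B) (suc n) f≡0 = coeff₁-applyUpTo (f ∘ suc) B n (f≡0 ∘ s≤s)

coeff-applyUpTo : ∀ (f : ℕ → List ℕ) B m n → (B ≤ m → coeff₁ (f m) n ≡ 0) →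
                  coeff (applyUpTo f B) m n ≡ coeff₁ (f m) n
coeff-applyUpTo f zero    m       n f≡0 = sym (f≡0 z≤n)
coeff-applyUpTo f (suc B) zero    n f≡0 = refl
coeff-applyUpTo f (suc B) (suc m) n f≡0 = coeff-applyUpTo (f ∘ suc) B m n (f≡0 ∘ s≤s)

-- The witness is the B × B table of absolute values. Outside the table `coeff` defaults to 0, which
-- is where f vanishes.
∈ℕ[q,t]⁺ : ∀ {f} → NonNegative f → FinitelySupported f → f ∈ℕ[q,t]
∈ℕ[q,t]⁺ {f} f≥0 (B , f≡0) = applyUpTo absRow B , λ m n → begin
  f m n                                  ≡⟨ ℤ.0≤i⇒+∣i∣≡i (f≥0 m n) ⟨
  + ∣ f m n ∣                            ≡⟨ cong +_ (absRow-coeff m n) ⟨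
  + coeff₁ (absRow m) n                    ≡⟨ cong +_ (coeff-applyUpTo absRow B m n λ B≤m →
                                              trans (absRow-coeff m n) (cong ∣_∣ (f≡0 m n (inj₁ B≤m)))) ⟨
  + coeff (applyUpTo absRow B) m n         ∎
  where
  absRow : ℕ → List ℕ
  absRow m = applyUpTo (λ n → ∣ f m n ∣) B

  absRow-coeff : ∀ m n → coeff₁ (absRow m) n ≡ ∣ f m n ∣
  absRow-coeff m n = coeff₁-applyUpTo _ B n λ B≤n → cong ∣_∣ (f≡0 m n (inj₂ B≤n))

-- Zeta series of principal ideals

module _ (P : FiniteGradedPoset) where
  open FiniteGradedPoset P

  -- Phrased through principal ideals rather than `Covers`, because inclusion-exclusion works with
  -- ideals: the ideal of z without z is empty, or the ideal of `w`, or the union of the ideals of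
  -- `w₁` and `w₂`, which intersect in the ideal of `w₃`. The equation rank `w₂` = 1 + rank `w₃`
  -- follows from the three rank equations of `two`.
  data LowerCovers (z : Carrier) : Set where
    none : (∀ u → u ≤ᴾ z → u ≡ z) → LowerCovers z
    one  : ∀ w → w ≤ᴾ z → rank z ≡ suc (rank w) →
           (∀ u → u ≤ᴾ z → u ≡ z ⊎ u ≤ᴾ w) → LowerCovers z
    two  : ∀ w₁ w₂ w₃ →
           w₁ ≤ᴾ z → rank z ≡ suc (rank w₁) →
           w₂ ≤ᴾ z → rank z ≡ suc (rank w₂) →
           w₃ ≤ᴾ w₁ → rank w₁ ≡ suc (rank w₃) → w₃ ≤ᴾ w₂ →
           (∀ u → u ≤ᴾ z → u ≡ z ⊎ u ≤ᴾ w₁ ⊎ u ≤ᴾ w₂) →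
           (∀ u → u ≤ᴾ w₁ → u ≤ᴾ w₂ → u ≤ᴾ w₃) → LowerCovers z

module PrincipalIdeals (P : FiniteGradedPoset)
         (0̂ : FiniteGradedPoset.Carrier P)
         (0̂-minimum : Minimum (FiniteGradedPoset._≤ᴾ_ P) 0̂) where
  open FiniteGradedPoset P

  -- Weak chains of length m in [x , z], weighted by q^totalRank.
  chainSum : ℕ → Carrier → Carrier → ℕ → ℤ
  chainSum zero    x z = q^ 0
  chainSum (suc m) x z n =
    ∑ᴸ elements λ w → ⟦ between? P x z w ⟧ ℤ.* qShift (rank w) (chainSum m w z) n

  private
    term : ∀ {p} {I : Set p} → Dec I → Carrier → (ℕ → ℤ) → ℕ → ℤ
    term I? w f n = ⟦ I? ⟧ ℤ.* qShift (rank w) f n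

  term-∑ᴸ : ∀ {A : Set} {p} {I : Set p} (I? : Dec I) w xs (f : A → ℕ → ℤ) n →
    term I? w (λ k → ∑ᴸ xs (λ x → f x k)) n ≡ ∑ᴸ xs (λ x → term I? w (f x) n)
  term-∑ᴸ I? w xs f n = trans
    (cong (⟦ I? ⟧ ℤ.*_) (qShift-∑ᴸ (rank w) xs f n))
    (*-distribˡ-∑ᴸ ⟦ I? ⟧ xs (λ x → qShift (rank w) (f x) n))

  term-cong : ∀ {p} {I : Set p} (I? : Dec I) w {f g} → f ≗ g → term I? w f ≗ term I? w g
  term-cong I? w f≗g n = cong (⟦ I? ⟧ ℤ.*_) (qShift-cong (rank w) f≗g n)

  term-term : ∀ {p q} {I : Set p} {J : Set q} (I? : Dec I) (J? : Dec J) w v f n →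
    term I? w (term J? v f) n ≡
    ⟦ I? ×-dec J? ⟧ ℤ.* qShift (rank w) (qShift (rank v) f) n
  term-term I? J? w v f n = begin
    ⟦ I? ⟧ ℤ.* qShift (rank w) (term J? v f) n
      ≡⟨ cong (⟦ I? ⟧ ℤ.*_) (qShift-* (rank w) ⟦ J? ⟧ (qShift (rank v) f) n) ⟩
    ⟦ I? ⟧ ℤ.* (⟦ J? ⟧ ℤ.* qShift (rank w) (qShift (rank v) f) n)
      ≡⟨ ℤ.*-assoc ⟦ I? ⟧ ⟦ J? ⟧ _ ⟨
    ⟦ I? ⟧ ℤ.* ⟦ J? ⟧ ℤ.* qShift (rank w) (qShift (rank v) f) n
      ≡⟨ cong (ℤ._* qShift (rank w) (qShift (rank v) f) n) (⟦⟧-× I? J?) ⟨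
    ⟦ I? ×-dec J? ⟧ ℤ.* qShift (rank w) (qShift (rank v) f) n ∎

  -- `chainSum` splits off the least entry of a chain, whereas comparing principal ideals calls for
  -- splitting off the greatest. In the induction both ends appear: pairs x ≤ w ≤ v ≤ z are listed
  -- once by w first and once by v first.
  chainSum-last : ∀ m x z n → chainSum (suc m) x z n ≡
    ∑ᴸ elements λ w → ⟦ between? P x z w ⟧ ℤ.* qShift (rank w) (chainSum m x w) n
  chainSum-last zero    x z n = refl
  chainSum-last (suc m) x z n = begin
    ∑ᴸ elements (λ w → term (between? P x z w) w (chainSum (suc m) w z) n)
      ≡⟨ ∑ᴸ-cong elements (λ w → trans
           (term-cong (between? P x z w) w (chainSum-last m w z) n)
           (term-∑ᴸ (between? P x z w) w elements
             (λ v → term (between? P w z v) v (chainSum m w v)) n)) ⟩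
    ∑ᴸ elements (λ w → ∑ᴸ elements λ v →
      term (between? P x z w) w (term (between? P w z v) v (chainSum m w v)) n)
      ≡⟨ ∑ᴸ-cong elements (λ w → ∑ᴸ-cong elements λ v → exchange w v) ⟩
    ∑ᴸ elements (λ w → ∑ᴸ elements λ v →
      term (between? P x z v) v (term (between? P x v w) w (chainSum m w v)) n)
      ≡⟨ ∑ᴸ-swap elements elements _ ⟩
    ∑ᴸ elements (λ v → ∑ᴸ elements λ w →
      term (between? P x z v) v (term (between? P x v w) w (chainSum m w v)) n)
      ≡⟨ ∑ᴸ-cong elements (λ v → term-∑ᴸ (between? P x z v) v elements
           (λ w → term (between? P x v w) w (chainSum m w v)) n) ⟨
    ∑ᴸ elements (λ v → term (between? P x z v) v (chainSum (suc m) x v) n) ∎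
    where
    exchange : ∀ w v →
      term (between? P x z w) w (term (between? P w z v) v (chainSum m w v)) n ≡
      term (between? P x z v) v (term (between? P x v w) w (chainSum m w v)) n
    exchange w v = begin
      term (between? P x z w) w (term (between? P w z v) v (chainSum m w v)) n
        ≡⟨ term-term (between? P x z w) (between? P w z v) w v _ n ⟩
      ⟦ between? P x z w ×-dec between? P w z v ⟧ ℤ.* _
        ≡⟨ cong₂ ℤ._*_
             (⟦⟧-cong (between? P x z w ×-dec between? P w z v)
                      (between? P x z v ×-dec between? P x v w)
               (λ { ((x≤w , _) , (w≤v , v≤z)) → (≤ᴾ-trans x≤w w≤v , v≤z) , (x≤w , w≤v) })
               (λ { ((_ , v≤z) , (x≤w , w≤v)) → (x≤w , ≤ᴾ-trans w≤v v≤z) , (w≤v , v≤z) }))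
             (qShift-comm (rank w) (rank v) (chainSum m w v) n) ⟩
      ⟦ between? P x z v ×-dec between? P x v w ⟧ ℤ.* _
        ≡⟨ term-term (between? P x z v) (between? P x v w) v w _ n ⟨
      term (between? P x z v) v (term (between? P x v w) w (chainSum m w v)) n ∎

  -- Prefixing x turns the lower bound on the first entry into one more link of the chain, so that
  -- the induction can move the bound from x to that entry. The upper bound ⊤ holds for every entry.
  tuples-sum : ∀ m x n →
    ∑ᴸ (tuples P m) (λ c → ⟦ linked? _≤ᴾ?_ (x ∷ c) ⟧ ℤ.* (q^ totalRank P c) n) ≡
    chainSum m x ⊤ n
  tuples-sum zero    x n = trans (ℤ.+-identityʳ _) (ℤ.*-identityˡ _)
  tuples-sum (suc m) x n = trans
    (∑ᴸ-cartesianProductWith _∷_ elements (tuples P m) _)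
    (∑ᴸ-cong elements λ w → begin
      ∑ᴸ (tuples P m) (λ c →
        ⟦ linked? _≤ᴾ?_ (x ∷ w ∷ c) ⟧ ℤ.* (q^ (rank w + totalRank P c)) n)
        ≡⟨ ∑ᴸ-cong (tuples P m) (λ c → splitHead w c) ⟩
      ∑ᴸ (tuples P m) (λ c → term (between? P x ⊤ w) w
        (λ k → ⟦ linked? _≤ᴾ?_ (w ∷ c) ⟧ ℤ.* (q^ totalRank P c) k) n)
        ≡⟨ term-∑ᴸ (between? P x ⊤ w) w (tuples P m) _ n ⟨
      term (between? P x ⊤ w) w
        (λ k → ∑ᴸ (tuples P m) λ c → ⟦ linked? _≤ᴾ?_ (w ∷ c) ⟧ ℤ.* (q^ totalRank P c) k) n
        ≡⟨ term-cong (between? P x ⊤ w) w (tuples-sum m w) n ⟩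
      term (between? P x ⊤ w) w (chainSum m w ⊤) n ∎)
    where
    splitHead : ∀ w (c : Vec Carrier m) →
      ⟦ linked? _≤ᴾ?_ (x ∷ w ∷ c) ⟧ ℤ.* (q^ (rank w + totalRank P c)) n ≡
      term (between? P x ⊤ w) w
        (λ k → ⟦ linked? _≤ᴾ?_ (w ∷ c) ⟧ ℤ.* (q^ totalRank P c) k) n
    splitHead w c = begin
      ⟦ linked? _≤ᴾ?_ (x ∷ w ∷ c) ⟧ ℤ.* (q^ (rank w + totalRank P c)) n
        ≡⟨ cong₂ ℤ._*_
             (⟦⟧-cong (linked? _≤ᴾ?_ (x ∷ w ∷ c))
                      (between? P x ⊤ w ×-dec linked? _≤ᴾ?_ (w ∷ c))
               (λ l → (Linked.head l , maximum w) , Linked.tail l)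
               (λ { ((x≤w , _) , l) → x≤w ∷ l }))
             (sym (qShift-q^ (rank w) (totalRank P c) n)) ⟩
      ⟦ between? P x ⊤ w ×-dec linked? _≤ᴾ?_ (w ∷ c) ⟧ ℤ.*
        qShift (rank w) (q^ totalRank P c) n
        ≡⟨ cong (ℤ._* qShift (rank w) (q^ totalRank P c) n)
             (⟦⟧-× (between? P x ⊤ w) (linked? _≤ᴾ?_ (w ∷ c))) ⟩
      ⟦ between? P x ⊤ w ⟧ ℤ.* ⟦ linked? _≤ᴾ?_ (w ∷ c) ⟧ ℤ.*
        qShift (rank w) (q^ totalRank P c) n
        ≡⟨ ℤ.*-assoc ⟦ between? P x ⊤ w ⟧ ⟦ linked? _≤ᴾ?_ (w ∷ c) ⟧ _ ⟩
      ⟦ between? P x ⊤ w ⟧ ℤ.*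
        (⟦ linked? _≤ᴾ?_ (w ∷ c) ⟧ ℤ.* qShift (rank w) (q^ totalRank P c) n)
        ≡⟨ cong (⟦ between? P x ⊤ w ⟧ ℤ.*_)
             (qShift-* (rank w) ⟦ linked? _≤ᴾ?_ (w ∷ c) ⟧ (q^ totalRank P c) n) ⟨
      term (between? P x ⊤ w) w
        (λ k → ⟦ linked? _≤ᴾ?_ (w ∷ c) ⟧ ℤ.* (q^ totalRank P c) k) n ∎

  -- The zeta series of the principal ideal of z.
  zeta : Carrier → Series
  zeta z m = chainSum m 0̂ z

  qZeta≈zeta-⊤ : qZeta P ≈ zeta ⊤
  qZeta≈zeta-⊤ m n = begin
    ∑ᴸ (weakChains P m) (λ c → (q^ totalRank P c) n)
      ≡⟨ ∑ᴸ-filter (linked? _≤ᴾ?_) (tuples P m) _ ⟩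
    ∑ᴸ (tuples P m) (λ c → ⟦ linked? _≤ᴾ?_ c ⟧ ℤ.* (q^ totalRank P c) n)
      ≡⟨ ∑ᴸ-cong (tuples P m) (λ c → cong (ℤ._* (q^ totalRank P c) n)
           (⟦⟧-cong (linked? _≤ᴾ?_ c) (linked? _≤ᴾ?_ (0̂ ∷ c)) cons Linked.tail)) ⟩
    ∑ᴸ (tuples P m) (λ c → ⟦ linked? _≤ᴾ?_ (0̂ ∷ c) ⟧ ℤ.* (q^ totalRank P c) n)
      ≡⟨ tuples-sum m 0̂ n ⟩
    chainSum m 0̂ ⊤ n ∎
    where
    cons : ∀ {m} {c : Vec Carrier m} → Linked _≤ᴾ_ c → Linked _≤ᴾ_ (0̂ ∷ c)
    cons []          = [-]
    cons l@[-]       = 0̂-minimum _ ∷ l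
    cons l@(_ ∷ _)   = 0̂-minimum _ ∷ l

  zeta-suc : ∀ z m n → zeta z (suc m) n ≡
    ∑ᴸ elements λ w → ⟦ w ≤ᴾ? z ⟧ ℤ.* qShift (rank w) (zeta w m) n
  zeta-suc z m n = trans (chainSum-last m 0̂ z n) (∑ᴸ-cong elements λ w →
    cong (ℤ._* qShift (rank w) (zeta w m) n)
      (⟦⟧-cong (between? P 0̂ z w) (w ≤ᴾ? z) proj₂ (0̂-minimum w ,_)))

  -- Removing the top element from a principal ideal

  rank-suc⇒≰ : ∀ {w z} → rank z ≡ suc (rank w) → ¬ z ≤ᴾ w
  rank-suc⇒≰ {w} {z} ρz z≤w =
    ℕ.1+n≰n (subst (_≤ rank w) ρz (rank-mono z w z≤w))

  summand : ℕ → ℕ → Carrier → ℤ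
  summand m n u = qShift (rank u) (zeta u m) n

  select : ∀ z m n →
    ∑ᴸ elements (λ u → ⟦ u ≟ z ⟧ ℤ.* summand m n u) ≡ qShift (rank z) (zeta z m) n
  select z m n = ∑ᴸ-select _≟_ elements-unique (elements-complete z) (summand m n)

  -- Multiplication by 1 - q^ρ(z) t cancels the chains that end at z. What is left is the zeta
  -- series of the ideal of z without z: here of the empty poset, in the next two lemmas of one
  -- ideal and of a union of two ideals.
  factor-zeta-none : ∀ {z} → (∀ u → u ≤ᴾ z → u ≡ z) → factor (rank z) (zeta z) ≈ 1#
  factor-zeta-none {z} min zero    n = ℤ.+-identityʳ _
  factor-zeta-none {z} min (suc m) n = ℤ.i≡j⇒i-j≡0 (begin
    zeta z (suc m) n
      ≡⟨ zeta-suc z m n ⟩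
    ∑ᴸ elements (λ u → ⟦ u ≤ᴾ? z ⟧ ℤ.* summand m n u)
      ≡⟨ ∑ᴸ-cong elements (λ u → cong (ℤ._* summand m n u)
           (⟦⟧-cong (u ≤ᴾ? z) (u ≟ z) (min u) reflexive)) ⟩
    ∑ᴸ elements (λ u → ⟦ u ≟ z ⟧ ℤ.* summand m n u)
      ≡⟨ select z m n ⟩
    qShift (rank z) (zeta z m) n ∎)

  factor-zeta-one : ∀ {z w} → w ≤ᴾ z → rank z ≡ suc (rank w) →
                    (∀ u → u ≤ᴾ z → u ≡ z ⊎ u ≤ᴾ w) → factor (rank z) (zeta z) ≈ zeta w
  factor-zeta-one {z} {w} w≤z ρz below zero    n = ℤ.+-identityʳ _
  factor-zeta-one {z} {w} w≤z ρz below (suc m) n = sym (x+y≡z⇒x≡z-y (begin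
    zeta w (suc m) n ℤ.+ qShift (rank z) (zeta z m) n
      ≡⟨ cong₂ ℤ._+_ (sym (zeta-suc w m n)) (select z m n) ⟨
    ∑ᴸ elements (λ u → ⟦ u ≤ᴾ? w ⟧ ℤ.* summand m n u) ℤ.+
    ∑ᴸ elements (λ u → ⟦ u ≟ z ⟧ ℤ.* summand m n u)
      ≡⟨ ∑ᴸ-distribʳ elements (λ u → ⟦ u ≤ᴾ? w ⟧) (λ u → ⟦ u ≟ z ⟧) (summand m n) ⟨
    ∑ᴸ elements (λ u → (⟦ u ≤ᴾ? w ⟧ ℤ.+ ⟦ u ≟ z ⟧) ℤ.* summand m n u)
      ≡⟨ ∑ᴸ-cong elements (λ u → cong (ℤ._* summand m n u) (split u)) ⟩
    ∑ᴸ elements (λ u → ⟦ u ≤ᴾ? z ⟧ ℤ.* summand m n u)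
      ≡⟨ zeta-suc z m n ⟨
    zeta z (suc m) n ∎))
    where
    split : ∀ u → ⟦ u ≤ᴾ? w ⟧ ℤ.+ ⟦ u ≟ z ⟧ ≡ ⟦ u ≤ᴾ? z ⟧
    split u with u ≤ᴾ? w | u ≟ z | u ≤ᴾ? z
    ... | yes u≤w | yes refl | _       = contradiction u≤w (rank-suc⇒≰ ρz)
    ... | yes u≤w | no _     | yes _   = refl
    ... | yes u≤w | no _     | no u≰z  = contradiction (≤ᴾ-trans u≤w w≤z) u≰z
    ... | no _    | yes _    | yes _   = refl
    ... | no _    | yes refl | no u≰z  = contradiction ≤ᴾ-refl u≰z
    ... | no u≰w  | no u≢z   | yes u≤z with below u u≤z
    ...   | inj₁ u≡z = contradiction u≡z u≢z
    ...   | inj₂ u≤w = contradiction u≤w u≰w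
    split u | no _ | no _ | no _ = refl

  -- Inclusion-exclusion is applied to the last entry u of a chain. The contribution of u depends on
  -- the ideal of u alone, so it is the same `summand` in the ideals of `z`, `w₁`, `w₂` and `w₃`,
  -- and only the indicators have to be compared.
  factor-zeta-two : ∀ {z w₁ w₂ w₃} →
    w₁ ≤ᴾ z → rank z ≡ suc (rank w₁) → w₂ ≤ᴾ z → rank z ≡ suc (rank w₂) →
    w₃ ≤ᴾ w₁ → w₃ ≤ᴾ w₂ →
    (∀ u → u ≤ᴾ z → u ≡ z ⊎ u ≤ᴾ w₁ ⊎ u ≤ᴾ w₂) →
    (∀ u → u ≤ᴾ w₁ → u ≤ᴾ w₂ → u ≤ᴾ w₃) →
    factor (rank z) (zeta z) ≈ zeta w₁ ⊕ (zeta w₂ ⊖ zeta w₃)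
  factor-zeta-two {z} {w₁} {w₂} {w₃} w₁≤z ρ₁ w₂≤z ρ₂ w₃≤w₁ w₃≤w₂ below meet zero n =
    lemma ((q^ 0) n)
    where
    lemma : ∀ x → x ℤ.- 0ℤ ≡ x ℤ.+ (x ℤ.- x)
    lemma = solve-∀
  factor-zeta-two {z} {w₁} {w₂} {w₃} w₁≤z ρ₁ w₂≤z ρ₂ w₃≤w₁ w₃≤w₂ below meet (suc m) n =
    -- The negative term is moved to the other side first, so that both sides are plain sums and can
    -- be compared summand by summand.
    rearrange (zeta z (suc m) n) (zeta w₃ (suc m) n) (qShift (rank z) (zeta z m) n)
      (zeta w₁ (suc m) n) (zeta w₂ (suc m) n) (begin
    zeta z (suc m) n ℤ.+ zeta w₃ (suc m) n
      ≡⟨ cong₂ ℤ._+_ (zeta-suc z m n) (zeta-suc w₃ m n) ⟩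
    ∑ᴸ elements (λ u → ⟦ u ≤ᴾ? z ⟧ ℤ.* summand m n u) ℤ.+
    ∑ᴸ elements (λ u → ⟦ u ≤ᴾ? w₃ ⟧ ℤ.* summand m n u)
      ≡⟨ ∑ᴸ-distribʳ elements (λ u → ⟦ u ≤ᴾ? z ⟧) (λ u → ⟦ u ≤ᴾ? w₃ ⟧) (summand m n) ⟨
    ∑ᴸ elements (λ u → (⟦ u ≤ᴾ? z ⟧ ℤ.+ ⟦ u ≤ᴾ? w₃ ⟧) ℤ.* summand m n u)
      ≡⟨ ∑ᴸ-cong elements (λ u → cong (ℤ._* summand m n u) (inclusion-exclusion u)) ⟩
    ∑ᴸ elements (λ u → (⟦ u ≟ z ⟧ ℤ.+ (⟦ u ≤ᴾ? w₁ ⟧ ℤ.+ ⟦ u ≤ᴾ? w₂ ⟧)) ℤ.* summand m n u)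
      ≡⟨ trans
           (∑ᴸ-distribʳ elements (λ u → ⟦ u ≟ z ⟧) (λ u → ⟦ u ≤ᴾ? w₁ ⟧ ℤ.+ ⟦ u ≤ᴾ? w₂ ⟧)
             (summand m n))
           (cong (λ s → ∑ᴸ elements (λ u → ⟦ u ≟ z ⟧ ℤ.* summand m n u) ℤ.+ s)
             (∑ᴸ-distribʳ elements (λ u → ⟦ u ≤ᴾ? w₁ ⟧) (λ u → ⟦ u ≤ᴾ? w₂ ⟧) (summand m n))) ⟩
    ∑ᴸ elements (λ u → ⟦ u ≟ z ⟧ ℤ.* summand m n u) ℤ.+
    (∑ᴸ elements (λ u → ⟦ u ≤ᴾ? w₁ ⟧ ℤ.* summand m n u) ℤ.+
     ∑ᴸ elements (λ u → ⟦ u ≤ᴾ? w₂ ⟧ ℤ.* summand m n u))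
      ≡⟨ cong₂ ℤ._+_ (select z m n)
           (cong₂ ℤ._+_ (sym (zeta-suc w₁ m n)) (sym (zeta-suc w₂ m n))) ⟩
    qShift (rank z) (zeta z m) n ℤ.+ (zeta w₁ (suc m) n ℤ.+ zeta w₂ (suc m) n) ∎)
    where
    rearrange : ∀ a b c d e → a ℤ.+ b ≡ c ℤ.+ (d ℤ.+ e) → a ℤ.- c ≡ d ℤ.+ (e ℤ.- b)
    rearrange a b c d e eq = begin
      a ℤ.- c                         ≡⟨ lemma₁ a b c ⟩
      (a ℤ.+ b) ℤ.- b ℤ.- c           ≡⟨ cong (λ s → s ℤ.- b ℤ.- c) eq ⟩
      (c ℤ.+ (d ℤ.+ e)) ℤ.- b ℤ.- c   ≡⟨ lemma₂ b c d e ⟩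
      d ℤ.+ (e ℤ.- b)                 ∎
      where
      lemma₁ : ∀ a b c → a ℤ.- c ≡ (a ℤ.+ b) ℤ.- b ℤ.- c
      lemma₁ = solve-∀
      lemma₂ : ∀ b c d e → (c ℤ.+ (d ℤ.+ e)) ℤ.- b ℤ.- c ≡ d ℤ.+ (e ℤ.- b)
      lemma₂ = solve-∀

    inclusion-exclusion : ∀ u →
      ⟦ u ≤ᴾ? z ⟧ ℤ.+ ⟦ u ≤ᴾ? w₃ ⟧ ≡ ⟦ u ≟ z ⟧ ℤ.+ (⟦ u ≤ᴾ? w₁ ⟧ ℤ.+ ⟦ u ≤ᴾ? w₂ ⟧)
    inclusion-exclusion u with u ≤ᴾ? z | u ≟ z | u ≤ᴾ? w₁ | u ≤ᴾ? w₂ | u ≤ᴾ? w₃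
    ... | _       | yes refl | yes z≤w | _       | _       = contradiction z≤w (rank-suc⇒≰ ρ₁)
    ... | _       | yes refl | _       | yes z≤w | _       = contradiction z≤w (rank-suc⇒≰ ρ₂)
    ... | no u≰z  | yes refl | _       | _       | _       = contradiction ≤ᴾ-refl u≰z
    ... | no u≰z  | no _     | yes u≤w | _       | _       = contradiction (≤ᴾ-trans u≤w w₁≤z) u≰z
    ... | no u≰z  | no _     | _       | yes u≤w | _       = contradiction (≤ᴾ-trans u≤w w₂≤z) u≰z
    ... | _       | _        | no u≰w  | _       | yes u≤w = contradiction (≤ᴾ-trans u≤w w₃≤w₁) u≰w
    ... | _       | _        | _       | no u≰w  | yes u≤w = contradiction (≤ᴾ-trans u≤w w₃≤w₂) u≰w
    ... | _       | _        | yes u≤w₁ | yes u≤w₂ | no u≰w = contradiction (meet u u≤w₁ u≤w₂) u≰w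
    ... | yes _   | yes _    | no _    | no _    | no _    = refl
    ... | yes _   | no _     | yes _   | yes _   | yes _   = refl
    ... | yes _   | no _     | yes _   | no _    | no _    = refl
    ... | yes _   | no _     | no _    | yes _   | no _    = refl
    ... | no _    | no _     | no _    | no _    | no _    = refl
    ... | yes u≤z | no u≢z   | no u≰w₁ | no u≰w₂ | no _ with below u u≤z
    ...   | inj₁ u≡z        = contradiction u≡z u≢z
    ...   | inj₂ (inj₁ u≤w) = contradiction u≤w u≰w₁
    ...   | inj₂ (inj₂ u≤w) = contradiction u≤w u≰w₂

  -- Recursion for the numerators of principal ideals

  idealNumerator : Carrier → Series
  idealNumerator z = zeta z · denominator (rank z)

  ·-denominator-cong : ∀ {f k l} → k ≡ l → f · denominator k ≈ f · denominator l
  ·-denominator-cong refl m n = refl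

  -- The top factor of the denominator of z is used up in removing z; the factors that remain form
  -- exactly the denominator of an element one rank lower.
  idealNumerator-suc : ∀ {z k f} → rank z ≡ suc k → factor (rank z) (zeta z) ≈ f →
                       idealNumerator z ≈ f · denominator k
  idealNumerator-suc {z} {k} {f} ρz eq m n = begin
    idealNumerator z m n                               ≡⟨ ·-denominator-cong {zeta z} ρz m n ⟩
    (zeta z · denominator (suc k)) m n                 ≡⟨ ·-denominator k (zeta z) m n ⟩
    (factor (suc k) (zeta z) · denominator k) m n
      ≡⟨ ·-cong {g = denominator k} (λ i j → trans (cong (λ r → factor r (zeta z) i j) (sym ρz)) (eq i j))
           (λ _ _ → refl) m n ⟩
    (f · denominator k) m n ∎

  idealNumerator-none : ∀ {z} → (∀ u → u ≤ᴾ z → u ≡ z) → idealNumerator z ≈ 1#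
  idealNumerator-none {z} min m n = begin
    idealNumerator z m n          ≡⟨ ·-denominator-cong {zeta z} ρz m n ⟩
    (zeta z · 1-q^ 0 t) m n       ≡⟨ ·-1-q^t 0 (zeta z) m n ⟩
    factor 0 (zeta z) m n         ≡⟨ cong (λ r → factor r (zeta z) m n) ρz ⟨
    factor (rank z) (zeta z) m n  ≡⟨ factor-zeta-none min m n ⟩
    1# m n                        ∎
    where
    ρz : rank z ≡ 0
    ρz = rank-minimal z min

  -- After z is removed, the remaining denominator has length rank `w₁` = rank `w₂`, which fits `w₁`
  -- and `w₂` but has one factor too many for `w₃`. The surplus factor 1 - q^ρ(w₁) t replaces
  -- -N_{w₃} by -N_{w₃} + q^ρ(w₁) t N_{w₃}, whence the shifted term with its positive sign.
  idealNumerator-two : ∀ {z w₁ w₂ w₃} →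
    w₁ ≤ᴾ z → rank z ≡ suc (rank w₁) → w₂ ≤ᴾ z → rank z ≡ suc (rank w₂) →
    w₃ ≤ᴾ w₁ → rank w₁ ≡ suc (rank w₃) → w₃ ≤ᴾ w₂ →
    (∀ u → u ≤ᴾ z → u ≡ z ⊎ u ≤ᴾ w₁ ⊎ u ≤ᴾ w₂) →
    (∀ u → u ≤ᴾ w₁ → u ≤ᴾ w₂ → u ≤ᴾ w₃) →
    idealNumerator z ≈ idealNumerator w₁ ⊕ (idealNumerator w₂ ⊖ idealNumerator w₃)
                       ⊕ shift (rank w₁) (idealNumerator w₃)
  idealNumerator-two {z} {w₁} {w₂} {w₃} w₁≤z ρ₁ w₂≤z ρ₂ w₃≤w₁ ρ₃ w₃≤w₂ below meet m n = begin
    idealNumerator z m n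
      ≡⟨ idealNumerator-suc ρ₁
           (factor-zeta-two w₁≤z ρ₁ w₂≤z ρ₂ w₃≤w₁ w₃≤w₂ below meet) m n ⟩
    ((zeta w₁ ⊕ (zeta w₂ ⊖ zeta w₃)) · D) m n
      ≡⟨ ·-distribʳ-⊕ (zeta w₁) (zeta w₂ ⊖ zeta w₃) D m n ⟩
    N w₁ ℤ.+ ((zeta w₂ ⊖ zeta w₃) · D) m n
      ≡⟨ cong (λ x → N w₁ ℤ.+ x) (·-distribʳ-⊖ (zeta w₂) (zeta w₃) D m n) ⟩
    N w₁ ℤ.+ ((zeta w₂ · D) m n ℤ.- (zeta w₃ · D) m n)
      ≡⟨ cong₂ (λ x y → N w₁ ℤ.+ (x ℤ.- y))
           (·-denominator-cong {zeta w₂} (ℕ.suc-injective (trans (sym ρ₁) ρ₂)) m n)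
           w₃-term ⟩
    N w₁ ℤ.+ (N w₂ ℤ.- (N w₃ ℤ.- S))
      ≡⟨ lemma (N w₁) (N w₂) (N w₃) S ⟩
    N w₁ ℤ.+ (N w₂ ℤ.- N w₃) ℤ.+ S ∎
    where
    D = denominator (rank w₁)

    N : Carrier → ℤ
    N w = idealNumerator w m n

    S = shift (rank w₁) (idealNumerator w₃) m n

    w₃-term : (zeta w₃ · D) m n ≡ N w₃ ℤ.- S
    w₃-term = begin
      (zeta w₃ · D) m n
        ≡⟨ ·-denominator-cong {zeta w₃} ρ₃ m n ⟩
      (zeta w₃ · denominator (suc (rank w₃))) m n
        ≡⟨ ·-denominator (rank w₃) (zeta w₃) m n ⟩
      (factor (suc (rank w₃)) (zeta w₃) · denominator (rank w₃)) m n
        ≡⟨ ·-factorˡ (suc (rank w₃)) (zeta w₃) (denominator (rank w₃)) m n ⟩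
      factor (suc (rank w₃)) (idealNumerator w₃) m n
        ≡⟨ cong (λ k → factor k (idealNumerator w₃) m n) ρ₃ ⟨
      N w₃ ℤ.- S ∎

    lemma : ∀ a b c s → a ℤ.+ (b ℤ.- (c ℤ.- s)) ≡ a ℤ.+ (b ℤ.- c) ℤ.+ s
    lemma = solve-∀

  -- Positivity and monotonicity by induction on the rank

  record Good (z : Carrier) : Set where
    field
      nonNegative       : NonNegative (idealNumerator z)
      finitelySupported : FinitelySupported (idealNumerator z)
      monotone          : ∀ w → w ≤ᴾ z → idealNumerator w ≼ idealNumerator z

  -- Monotonicity is what absorbs the negative term of idealNumerator-two.
  good : (∀ z → LowerCovers P z) → ∀ k z → rank z < k → Good z
  good covers (suc k) z (s≤s ρz≤k) with covers z
  ... | none min = record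
    { nonNegative       = λ m n → subst (0ℤ ℤ.≤_) (sym (N≈ m n)) (1#-nonneg m n)
    ; finitelySupported = ≈-finitelySupported N≈ 1#-finitelySupported
    ; monotone          = λ w w≤z m n →
        ℤ.≤-reflexive (cong (λ v → idealNumerator v m n) (min w w≤z))
    }
    where
    N≈ = idealNumerator-none min

    1#-nonneg : NonNegative 1#
    1#-nonneg zero    zero    = ℤ.+≤+ z≤n
    1#-nonneg zero    (suc n) = ℤ.≤-refl
    1#-nonneg (suc m) n       = ℤ.≤-refl
  ... | one w w≤z ρw below = record
    { nonNegative       = λ m n → subst (0ℤ ℤ.≤_) (sym (N≈ m n)) (Gw.nonNegative m n)
    ; finitelySupported = ≈-finitelySupported N≈ Gw.finitelySupported
    ; monotone          = mono
    }
    where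
    N≈ : idealNumerator z ≈ idealNumerator w
    N≈ = idealNumerator-suc ρw (factor-zeta-one w≤z ρw below)

    module Gw = Good (good covers k w (subst (_≤ k) ρw ρz≤k))

    mono : ∀ u → u ≤ᴾ z → idealNumerator u ≼ idealNumerator z
    mono u u≤z m n with below u u≤z
    ... | inj₁ refl = ℤ.≤-refl
    ... | inj₂ u≤w  = subst (idealNumerator u m n ℤ.≤_) (sym (N≈ m n)) (Gw.monotone u u≤w m n)
  ... | two w₁ w₂ w₃ w₁≤z ρ₁ w₂≤z ρ₂ w₃≤w₁ ρ₃ w₃≤w₂ below meet = record
    { nonNegative       = λ m n → ℤ.≤-trans (G₁.nonNegative m n) (N₁≼N m n)
    ; finitelySupported = ≈-finitelySupported N≈
        (zip-finitelySupported ℤ._+_ refl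
          (zip-finitelySupported ℤ._+_ refl G₁.finitelySupported
            (zip-finitelySupported ℤ._-_ refl G₂.finitelySupported G₃.finitelySupported))
          (shift-finitelySupported (rank w₁) G₃.finitelySupported))
    ; monotone          = mono
    }
    where
    N : Carrier → Series
    N = idealNumerator

    N≈ : N z ≈ N w₁ ⊕ (N w₂ ⊖ N w₃) ⊕ shift (rank w₁) (N w₃)
    N≈ = idealNumerator-two w₁≤z ρ₁ w₂≤z ρ₂ w₃≤w₁ ρ₃ w₃≤w₂ below meet

    w₁<k : rank w₁ < k
    w₁<k = subst (_≤ k) ρ₁ ρz≤k

    module G₁ = Good (good covers k w₁ w₁<k)
    module G₂ = Good (good covers k w₂ (subst (_≤ k) ρ₂ ρz≤k))
    -- `w₃` lies two ranks below z; the bound k, rather than an exact rank, lets the induction reach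
    -- it.
    module G₃ = Good (good covers k w₃ (ℕ.<-trans (ℕ.≤-reflexive (sym ρ₃)) w₁<k))

    S≥0 : NonNegative (shift (rank w₁) (N w₃))
    S≥0 = shift-nonneg (rank w₁) G₃.nonNegative

    sum-≤ : ∀ {a b c s} → c ℤ.≤ b → 0ℤ ℤ.≤ s → a ℤ.≤ a ℤ.+ (b ℤ.- c) ℤ.+ s
    sum-≤ {a} {b} {c} {s} c≤b 0≤s = subst (ℤ._≤ a ℤ.+ (b ℤ.- c) ℤ.+ s)
      (trans (ℤ.+-identityʳ _) (ℤ.+-identityʳ a))
      (ℤ.+-mono-≤ (ℤ.+-monoʳ-≤ a (ℤ.i≤j⇒0≤j-i c≤b)) 0≤s)

    N₁≼N : N w₁ ≼ N z
    N₁≼N m n = subst (N w₁ m n ℤ.≤_) (sym (N≈ m n))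
      (sum-≤ (G₂.monotone w₃ w₃≤w₂ m n) (S≥0 m n))

    -- With `w₁` and `w₂` exchanged in the unshifted part of the recursion, the difference to be
    -- absorbed is N_{w₁} - N_{w₃}.
    N₂≼N : N w₂ ≼ N z
    N₂≼N m n = subst (N w₂ m n ℤ.≤_)
      (trans (cong (ℤ._+ shift (rank w₁) (N w₃) m n) (exchange (N w₂ m n) (N w₁ m n) (N w₃ m n)))
             (sym (N≈ m n)))
      (sum-≤ (G₁.monotone w₃ w₃≤w₁ m n) (S≥0 m n))
      where
      exchange : ∀ a b c → a ℤ.+ (b ℤ.- c) ≡ b ℤ.+ (a ℤ.- c)
      exchange = solve-∀

    mono : ∀ u → u ≤ᴾ z → N u ≼ N z
    mono u u≤z m n with below u u≤z
    ... | inj₁ refl         = ℤ.≤-refl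
    ... | inj₂ (inj₁ u≤w₁)  = ℤ.≤-trans (G₁.monotone u u≤w₁ m n) (N₁≼N m n)
    ... | inj₂ (inj₂ u≤w₂)  = ℤ.≤-trans (G₂.monotone u u≤w₂ m n) (N₂≼N m n)

  numerator∈ℕ[q,t] : (∀ z → LowerCovers P z) → numerator P ∈ℕ[q,t]
  numerator∈ℕ[q,t] covers = ∈ℕ[q,t]⁺
    (λ m n → subst (0ℤ ℤ.≤_) (sym (num≈ m n)) (nonNegative m n))
    (≈-finitelySupported num≈ finitelySupported)
    where
    open Good (good covers (suc height) ⊤ ℕ.≤-refl)

    num≈ : numerator P ≈ idealNumerator ⊤
    -- `height` is `rank ⊤` by definition, so the two denominators agree.
    num≈ = ·-cong {g = denominator height} qZeta≈zeta-⊤ (λ _ _ → refl)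

-- Lower covers in intervals and in F̂

module _ (P : FiniteGradedPoset) where
  open FiniteGradedPoset P

  -- A lower cover `w` of z keeps its role in the interval if x ≤ `w`; otherwise no element of the
  -- interval lies below it and it drops out, so that `two` may shrink to `one`. If x lies below
  -- both `w₁` and `w₂`, it lies below their meet `w₃`, which therefore survives. If no lower cover
  -- survives, z is x. Differences of ranks are unchanged by subtracting the rank of x.
  interval-lowerCovers : (∀ z → LowerCovers P z) →
    ∀ x y (x≤y : x ≤ᴾ y) z → LowerCovers (interval P x y x≤y) z
  interval-lowerCovers covers x y x≤y z@(z′ , [ p ]) = go (covers z′)
    where
    module I = FiniteGradedPoset (interval P x y x≤y)

    above : (u : I.Carrier) → x ≤ᴾ value u
    above (u , [ q ]) = proj₁ (recompute (between? P x y u) q)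

    z≤y : z′ ≤ᴾ y
    z≤y = I.maximum z

    ≡ᴵ : {u v : I.Carrier} → value u ≡ value v → u ≡ v
    ≡ᴵ = refinement-≡ (between? P x y)

    embed : ∀ w → x ≤ᴾ w → w ≤ᴾ z′ → I.Carrier
    embed w x≤w w≤z = w , [ (x≤w , ≤ᴾ-trans w≤z z≤y) ]

    rank-pred : ∀ {v w} → x ≤ᴾ w → rank v ≡ suc (rank w) →
                rank v ∸ rank x ≡ suc (rank w ∸ rank x)
    rank-pred {w = w} x≤w ρv =
      trans (cong (_∸ rank x) ρv) (ℕ.+-∸-assoc 1 (rank-mono x w x≤w))

    bottom : x ≡ z′ → LowerCovers (interval P x y x≤y) z
    bottom refl = none λ u u≤z → ≡ᴵ (antisym u≤z (above u))

    single : ∀ w → x ≤ᴾ w → w ≤ᴾ z′ → rank z′ ≡ suc (rank w) →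
             (∀ u → x ≤ᴾ u → u ≤ᴾ z′ → u ≡ z′ ⊎ u ≤ᴾ w) →
             LowerCovers (interval P x y x≤y) z
    single w x≤w w≤z ρz below = one (embed w x≤w w≤z) w≤z (rank-pred x≤w ρz)
      λ u u≤z → Sum.map₁ ≡ᴵ (below (value u) (above u) u≤z)

    go : LowerCovers P z′ → LowerCovers (interval P x y x≤y) z
    go (none min) = none λ u u≤z → ≡ᴵ (min (value u) u≤z)
    go (one w w≤z ρz below) with below x (above z)
    ... | inj₁ x≡z = bottom x≡z
    ... | inj₂ x≤w = single w x≤w w≤z ρz λ u _ → below u
    go (two w₁ w₂ w₃ w₁≤z ρ₁ w₂≤z ρ₂ w₃≤w₁ ρ₃ w₃≤w₂ below meet)
      with x ≤ᴾ? w₁ | x ≤ᴾ? w₂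
    ... | yes x≤w₁ | yes x≤w₂ = two
      (embed w₁ x≤w₁ w₁≤z) (embed w₂ x≤w₂ w₂≤z) (embed w₃ x≤w₃ (≤ᴾ-trans w₃≤w₁ w₁≤z))
      w₁≤z (rank-pred x≤w₁ ρ₁) w₂≤z (rank-pred x≤w₂ ρ₂) w₃≤w₁ (rank-pred x≤w₃ ρ₃) w₃≤w₂
      (λ u u≤z → Sum.map₁ ≡ᴵ (below (value u) u≤z))
      (λ u → meet (value u))
      where
      x≤w₃ : x ≤ᴾ w₃
      x≤w₃ = meet x x≤w₁ x≤w₂
    ... | yes x≤w₁ | no  x≰w₂ = single w₁ x≤w₁ w₁≤z ρ₁ λ u x≤u u≤z →
      Sum.map₂ (λ { (inj₁ u≤w₁) → u≤w₁
                  ; (inj₂ u≤w₂) → contradiction (≤ᴾ-trans x≤u u≤w₂) x≰w₂ }) (below u u≤z)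
    ... | no  x≰w₁ | yes x≤w₂ = single w₂ x≤w₂ w₂≤z ρ₂ λ u x≤u u≤z →
      Sum.map₂ (λ { (inj₁ u≤w₁) → contradiction (≤ᴾ-trans x≤u u≤w₁) x≰w₁
                  ; (inj₂ u≤w₂) → u≤w₂ }) (below u u≤z)
    ... | no  x≰w₁ | no  x≰w₂ with below x (above z)
    ...   | inj₁ x≡z         = bottom x≡z
    ...   | inj₂ (inj₁ x≤w₁) = contradiction x≤w₁ x≰w₁
    ...   | inj₂ (inj₂ x≤w₂) = contradiction x≤w₂ x≰w₂

  interval-numerator∈ℕ[q,t] : (∀ z → LowerCovers P z) →
    ∀ x y (x≤y : x ≤ᴾ y) → numerator (interval P x y x≤y) ∈ℕ[q,t]
  interval-numerator∈ℕ[q,t] covers x y x≤y =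
    PrincipalIdeals.numerator∈ℕ[q,t] (interval P x y x≤y)
      (x , [ (≤ᴾ-refl , x≤y) ])
      (λ { (z , [ p ]) → proj₁ (recompute (between? P x y z) p) })
      (interval-lowerCovers covers x y x≤y)

-- Lower covers in the augmented Ferrers-cell lattice

module _ {r : ℕ} (r≥1 : r ≥ 1) (b : Fin r → ℕ)
         (b-decreasing : ∀ i j → i Fin.≤ j → b i ≥ b j)
         (b-diagonal : ∀ i → b i ≥ row i) where

  private
    P = F̂ r≥1 b b-decreasing b-diagonal
    open FiniteGradedPoset P

    cell-bounds : (z : Cell b) → IsCell b (value z)
    cell-bounds = isCell r≥1 b b-decreasing b-diagonal

    cell-≡ : {u v : Cell b} → value u ≡ value v → u ≡ v
    cell-≡ = refinement-≡ (isCell? b)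

    antisymᶜ : ∀ {u v : Fin r × ℕ} → u ≤ᶜ v → v ≤ᶜ u → u ≡ v
    antisymᶜ = IsDecPartialOrder.antisym ≤ᶜ-isDecPartialOrder

  -- A diagonal cell has only 0̂ strictly below it. Off the diagonal (i,c) covers its left neighbour
  -- (i,c-1), and also (i+1,c) if that is a cell. In the latter case the meet is (i+1,c-1), or 0̂
  -- when (i+1,c) is on the diagonal.
  F̂-lowerCovers : ∀ z → LowerCovers P z
  F̂-lowerCovers ⊥₋ = none λ { ⊥₋ _ → refl }
  F̂-lowerCovers [ z@((i , zero) , _) ] = contradiction (proj₁ (cell-bounds z)) λ ()
  F̂-lowerCovers [ z@((i , suc c) , _) ] with ℕ.m≤n⇒m<n∨m≡n (proj₁ (cell-bounds z))
  ... | inj₂ i≡c = one ⊥₋ (⊥₋≤ _) (cong (_+ 1) (ℕ.m≤n⇒m∸n≡0 (ℕ.≤-reflexive (sym i≡c)))) λ where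
    ⊥₋                  _                 → inj₂ (⊥₋≤ _)
    [ v@((k , e) , _) ] [ (i≤k , e≤c) ] → inj₁ (cong [_] (cell-≡ (antisymᶜ
      (i≤k , e≤c)
      ( ℕ.≤-trans (proj₁ (cell-bounds v)) (ℕ.≤-trans e≤c (ℕ.≤-reflexive (sym i≡c)))
      , ℕ.≤-trans (ℕ.≤-reflexive (sym i≡c)) (ℕ.≤-trans i≤k (proj₁ (cell-bounds v)))))))
  ... | inj₁ (s≤s i≤c) = covers
    where
    left : Cell b
    left = (i , c) , [ (i≤c , ℕ.≤-trans (ℕ.n≤1+n c) (proj₂ (cell-bounds z))) ]

    left≤z : [ left ] ≤ᴾ [ z ]
    left≤z = [ (ℕ.≤-refl , ℕ.n≤1+n c) ]

    ρz : ρ̂ r≥1 b b-decreasing b-diagonal [ z ] ≡ suc (c ∸ row i + 1)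
    ρz = cong (_+ 1) (ℕ.+-∸-assoc 1 i≤c)

    -- Rows after i are kept apart, because the shape b decides whether their cells reach the column
    -- of `z`.
    split : ∀ v → value v ≤ᶜ value z →
            v ≡ z ⊎ value v ≤ᶜ (i , c) ⊎ row i < row (proj₁ (value v))
    split v (i≤k , e≤1+c) with ℕ.m≤n⇒m<n∨m≡n i≤k
    ... | inj₁ i<k = inj₂ (inj₂ i<k)
    ... | inj₂ i≡k with ℕ.m≤n⇒m<n∨m≡n e≤1+c
    ...   | inj₁ (s≤s e≤c) = inj₂ (inj₁ (i≤k , e≤c))
    ...   | inj₂ e≡1+c     = inj₁ (cell-≡ (antisymᶜ (i≤k , e≤1+c)
              (ℕ.≤-reflexive (sym i≡k) , ℕ.≤-reflexive (sym e≡1+c))))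

    -- The hypothesis is that all rows after i stop short of the column of `z`; a cell of such a row
    -- below `z` is then below `left` too.
    single : (∀ (v : Cell b) → row i < row (proj₁ (value v)) → proj₂ (value v) ≤ c) →
             LowerCovers P [ z ]
    single ≤c = one [ left ] left≤z ρz λ where
      ⊥₋    _         → inj₂ (⊥₋≤ _)
      [ v ] [ v≤z ] → Sum.map (cong [_])
        (λ { (inj₁ v≤left) → [ v≤left ]
           ; (inj₂ i<k)    → [ (proj₁ v≤z , ≤c v i<k) ] })
        (split v v≤z)

    module _ (i⁺ : Fin r) (i⁺≡ : toℕ i⁺ ≡ suc (toℕ i)) (c<b : suc c ≤ b i⁺) where

      down : Cell b
      down = (i⁺ , suc c) , [ (subst (λ k → suc k ≤ suc c) (sym i⁺≡) (s≤s i≤c) , c<b) ]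

      down≤z : [ down ] ≤ᴾ [ z ]
      down≤z = [ (subst (λ k → row i ≤ suc k) (sym i⁺≡) (ℕ.n≤1+n _) , ℕ.≤-refl) ]

      ρz′ : ρ̂ r≥1 b b-decreasing b-diagonal [ z ] ≡ suc (suc c ∸ row i⁺ + 1)
      ρz′ = trans ρz (cong (λ k → suc (c ∸ k + 1)) (sym i⁺≡))

      below : ∀ u → u ≤ᴾ [ z ] → u ≡ [ z ] ⊎ u ≤ᴾ [ down ] ⊎ u ≤ᴾ [ left ]
      below ⊥₋    _               = inj₂ (inj₂ (⊥₋≤ _))
      below [ v ] [ v≤z@(_ , e≤) ] = Sum.map (cong [_])
        (λ { (inj₁ v≤left) → inj₂ [ v≤left ]
           ; (inj₂ i<k)    → inj₁ [ (subst (λ k → suc k ≤ row (proj₁ (value v))) (sym i⁺≡) i<k , e≤) ] })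
        (split v v≤z)

      double : LowerCovers P [ z ]
      double with row i⁺ ℕ.≤? c
      -- `down` takes the place of `w₁` because it shares its row with the meet, so the required
      -- rank equation is a single step along that row.
      ... | yes i⁺≤c = two [ down ] [ left ]
        [ ((i⁺ , c) , [ (i⁺≤c , ℕ.≤-trans (ℕ.n≤1+n c) c<b) ]) ]
        down≤z ρz′ left≤z ρz
        [ (ℕ.≤-refl , ℕ.n≤1+n c) ] (cong (_+ 1) (ℕ.+-∸-assoc 1 i⁺≤c))
        [ (subst (λ k → row i ≤ suc k) (sym i⁺≡) (ℕ.n≤1+n _) , ℕ.≤-refl) ]
        below
        λ { ⊥₋    _               _               → ⊥₋≤ _
          ; [ v ] [ (i⁺≤k , _) ] [ (_ , e≤c) ] → [ (i⁺≤k , e≤c) ] }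
      -- Here `down` is on the diagonal and has rank 1. A cell below both `down` and `left` would
      -- have its row number at least `row i⁺` and its column at most c, hence would lie outside the
      -- diagram.
      ... | no i⁺≰c = two [ down ] [ left ] ⊥₋
        down≤z ρz′ left≤z ρz
        (⊥₋≤ _) (cong (_+ 1) (ℕ.m≤n⇒m∸n≡0 (ℕ.≰⇒> i⁺≰c)))
        (⊥₋≤ _)
        below
        λ { ⊥₋    _               _               → ⊥₋≤ _
          ; [ v ] [ (i⁺≤k , _) ] [ (_ , e≤c) ] →
              contradiction (ℕ.≤-trans i⁺≤k (ℕ.≤-trans (proj₁ (cell-bounds v)) e≤c)) i⁺≰c }

    covers : LowerCovers P [ z ]
    covers with suc (toℕ i) ℕ.<? r
    ... | no  i⁺≮r = single λ { ((k , _) , _) (s≤s i<k) →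
      contradiction (ℕ.≤-<-trans i<k (Fin.toℕ<n k)) i⁺≮r }
    ... | yes i⁺<r with suc c ℕ.≤? b (fromℕ< i⁺<r)
    ...   | yes c<b = double (fromℕ< i⁺<r) (Fin.toℕ-fromℕ< i⁺<r) c<b
    -- Since b is decreasing, once the next row stops before the column of `z`, so does every later
    -- row.
    ...   | no  c≮b = single λ { v@((k , _) , _) (s≤s i<k) →
      ℕ.≤-pred (ℕ.≤-trans (s≤s (ℕ.≤-trans (proj₂ (cell-bounds v))
        (b-decreasing (fromℕ< i⁺<r) k
          (subst (_≤ toℕ k) (sym (Fin.toℕ-fromℕ< i⁺<r)) i<k)))) (ℕ.≰⇒> c≮b)) }

corollary5p9 : ∀ {r : ℕ} (r≥1 : r ≥ 1) (b : Fin r → ℕ)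
    (b-decreasing : ∀ i j → i Fin.≤ j → b i ≥ b j)
    (b-diagonal : ∀ i → b i ≥ row i) →
    let P = F̂ r≥1 b b-decreasing b-diagonal
        open FiniteGradedPoset P
    in (x y : Carrier) (x≤y : x ≤ᴾ y) →
       numerator (interval P x y x≤y) ∈ℕ[q,t]
corollary5p9 r≥1 b b-decreasing b-diagonal =
  interval-numerator∈ℕ[q,t] (F̂ r≥1 b b-decreasing b-diagonal)
    (F̂-lowerCovers r≥1 b b-decreasing b-diagonal)
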